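{- Let $u$ be a field ordinal. Then $\overline{u} = \sup\{\overline{u}^n \mid n \in \mathbb{N}, n \geq 1\}$, where $\overline{u}$ is the algebraic closure of $u$ in $\mathrm{On}_2$ and $\overline{u}^n$ is the $n$-closure of $u$ in $\mathrm{On}_2$ (all of these are ordinals).
   Context: $\oplus$ and $\otimes$ denote Nim-sum and Nim-product of ordinals, defined recursively by $\alpha \oplus \beta = \operatorname{mex}\{\alpha' \oplus \beta, \alpha \oplus \beta' \mid \alpha'<\alpha, \beta'<\beta\}$ and $\alpha \otimes \beta = \operatorname{mex}\{(\alpha' \otimes \beta) \oplus (\alpha \otimes \beta') \oplus (\alpha' \otimes \beta') \mid \alpha'<\alpha, \beta'<\beta\}$, where $\operatorname{mex}(S)$ is the least ordinal not in $S$. With these operations the class of ordinals is a Field of characteristic 2, denoted $\mathrm{On}_2$. An ordinal $u$ is identified with the set of smaller ordinals; a field ordinal is an ordinal $u$ that is a subfield of $\mathrm{On}_2$. $\overline{u}$ is the set of all ordinals that are algebraic over $u$ (Nim operations). For an integer $n \geq 1$, a field $F$ is $n$-closed if every non-constant polynomial in $F[X]$ of degree at most $n$ has at least one root in $F$. The $n$-closure $\overline{u}^n$ is the intersection of all $n$-closed fields $F$ with $u \subset F \subset \overline{u}$. -}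

module Defs where

open import Algebra.Bundles.Raw using (RawSemiring)
import Algebra.Definitions.RawSemiring as RawSemiringDefinitions
open import Data.Empty using (⊥)
open import Data.Fin.Base using (toℕ; fromℕ)
open import Data.Nat.Base as ℕ using (ℕ; suc)
open import Data.Product.Base using (Σ-syntax; ∃-syntax; _×_; _,_; proj₁; proj₂)
open import Data.Sum.Base using (_⊎_; inj₁; inj₂; [_,_]; [_,_]′)
open import Data.Unit.Base using (⊤)
open import Data.Vec.Functional using (Vector)
open import Level using (Level; 0ℓ) renaming (suc to lsuc; _⊔_ to _⊔ˡ_)
open import Relation.Binary.Definitions using (_Respects_)
open import Relation.Nullary.Negation.Core using (¬_)
open import Relation.Unary using (Pred; _⊆_; _≐_)

-- Sets as well-founded trees (Aczel): 'set A f' is { f a | a : A }, with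
-- extensional equality and membership.

data 𝕍 : Set₁ where
  set : (A : Set) → (A → 𝕍) → 𝕍

Index : 𝕍 → Set
Index (set A f) = A

elem : (x : 𝕍) → Index x → 𝕍
elem (set A f) = f

infix 4 _≋_ _∈_

_≋_ : 𝕍 → 𝕍 → Set
set A f ≋ set B g = (∀ a → ∃[ b ] f a ≋ g b) × (∀ b → ∃[ a ] f a ≋ g b)

_∈_ : 𝕍 → 𝕍 → Set
x ∈ y = ∃[ b ] x ≋ elem y b

IsTransitive : 𝕍 → Set₁
IsTransitive x = ∀ y z → y ∈ x → z ∈ y → z ∈ x

record IsOrd (x : 𝕍) : Set₁ where
  constructor mkIsOrd
  field
    transitive      : IsTransitive x
    elem-transitive : ∀ y → y ∈ x → IsTransitive y

open IsOrd public

≋-refl : ∀ {x} → x ≋ x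
≋-refl {set A f} = (λ a → a , ≋-refl) , (λ a → a , ≋-refl)

≋-sym : ∀ {x y} → x ≋ y → y ≋ x
≋-sym {set A f} {set B g} (p , q) =
  (λ b → proj₁ (q b) , ≋-sym (proj₂ (q b))) ,
  (λ a → proj₁ (p a) , ≋-sym (proj₂ (p a)))

≋-trans : ∀ {x y z} → x ≋ y → y ≋ z → x ≋ z
≋-trans {set A f} {set B g} {set C h} (p , q) (r , s) =
  (λ a → let b , e = p a; c , e′ = r b in c , ≋-trans e e′) ,
  (λ c → let b , e′ = s c; a , e = q b in a , ≋-trans e e′)

∈-respˡ : ∀ {x y z} → x ≋ y → x ∈ z → y ∈ z
∈-respˡ x≋y (c , e) = c , ≋-trans (≋-sym x≋y) e

∈-respʳ : ∀ {x y z} → x ≋ y → z ∈ x → z ∈ y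
∈-respʳ {set A f} {set B g} (p , _) (a , e) =
  let b , e′ = p a in b , ≋-trans e e′

elem-∈ : ∀ x i → elem x i ∈ x
elem-∈ x i = i , ≋-refl

elem-isOrd : ∀ x → IsOrd x → ∀ i → IsOrd (elem x i)
elem-isOrd x (mkIsOrd t ts) i = mkIsOrd
  (ts _ (elem-∈ x i)) λ y y∈ → ts y (t (elem x i) y (elem-∈ x i) y∈)

∈-irrefl : ∀ x → ¬ (x ∈ x)
∈-irrefl x@(set A f) x∈x@(a , e) =
  ∈-irrefl (f a) (∈-respˡ {x} {f a} {f a} e (∈-respʳ {x} {f a} {x} e x∈x))

-- The mex of a small family of ordinals, given by its set of predecessors:
-- the members of the family all of whose predecessors are members.  'mex-∉'
-- and 'mex-⊆' show that it is the least ordinal not in the family.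

mex : {I : Set} → (I → 𝕍) → 𝕍
mex {I} h =
  set (Σ[ i ∈ I ] (∀ k → ∃[ j ] elem (h i) k ≋ h j)) (λ p → h (proj₁ p))

mex-⊆ : ∀ {I} (h : I → 𝕍) {x} → x ∈ mex h → ∃[ i ] x ≋ h i
mex-⊆ h ((i , _) , e) = i , e

mex-∉ : ∀ {I} (h : I → 𝕍) → ¬ (∃[ i ] mex h ≋ h i)
mex-∉ h (i , e) = ∈-irrefl (mex h)
  ((i , λ k → mex-⊆ h (∈-respʳ {h i} (≋-sym {mex h} e) (elem-∈ (h i) k))) , e)

mex-isOrd : ∀ {I} (h : I → 𝕍) → (∀ i → IsOrd (h i)) → IsOrd (mex h)
mex-isOrd h hOrd = mkIsOrd trans λ y ((i , _) , e) z w z∈y w∈z →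
  ∈-respʳ {h i} (≋-sym {y} e)
    (transitive (hOrd i) z w (∈-respʳ {y} e z∈y) w∈z)
  where
  trans : IsTransitive (mex h)
  trans y z ((i , below) , e) z∈y =
    let z∈hi   = ∈-respʳ {y} e z∈y
        k , e₁ = z∈hi
        j , e₂ = below k
        z≋hj   = ≋-trans {z} e₁ e₂
    in (j , λ l →
          let w      = elem (h j) l
              w∈z    = ∈-respʳ {h j} (≋-sym {z} z≋hj) (elem-∈ (h j) l)
              m , e₃ = transitive (hOrd i) z w z∈hi w∈z
              n , e₄ = below m
          in n , ≋-trans {w} e₃ e₄)
     , z≋hj

mex-cong : ∀ {I J} {h : I → 𝕍} {k : J → 𝕍} →
           (∀ i → ∃[ j ] h i ≋ k j) → (∀ j → ∃[ i ] h i ≋ k j) → mex h ≋ mex k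
mex-cong {I} {J} {h} {k} p q =
  (λ (i , below) → let j , e = p i in
    (j , λ l → let m , e₁ = ∈-respʳ {k j} (≋-sym {h i} e) (elem-∈ (k j) l)
                   n , e₂ = below m
                   o , e₃ = p n
               in o , ≋-trans {elem (k j) l} e₁ (≋-trans {elem (h i) m} e₂ e₃)) , e) ,
  (λ (j , below) → let i , e = q j in
    (i , λ l → let m , e₁ = ∈-respʳ {h i} e (elem-∈ (h i) l)
                   n , e₂ = below m
                   o , e₃ = q n
               in o , ≋-trans {elem (h i) l} e₁
                        (≋-trans {elem (k j) m} e₂ (≋-sym {h o} e₃))) , e)

infixl 6 _⊕ⱽ_ _⊕_
infixl 7 _⊗ⱽ_ _⊗_

_⊕ⱽ_ : 𝕍 → 𝕍 → 𝕍
x@(set A f) ⊕ⱽ y@(set B g) =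
  mex {A ⊎ B} [ (λ a → f a ⊕ⱽ y) , (λ b → x ⊕ⱽ g b) ]′

_⊗ⱽ_ : 𝕍 → 𝕍 → 𝕍
x@(set A f) ⊗ⱽ y@(set B g) =
  mex {A × B} λ (a , b) → (f a ⊗ⱽ y) ⊕ⱽ (x ⊗ⱽ g b) ⊕ⱽ (f a ⊗ⱽ g b)

⊕ⱽ-isOrd : ∀ x y → IsOrd x → IsOrd y → IsOrd (x ⊕ⱽ y)
⊕ⱽ-isOrd x@(set A f) y@(set B g) ox oy = mex-isOrd _
  [ (λ a → ⊕ⱽ-isOrd (f a) y (elem-isOrd x ox a) oy)
  , (λ b → ⊕ⱽ-isOrd x (g b) ox (elem-isOrd y oy b)) ]

⊗ⱽ-isOrd : ∀ x y → IsOrd x → IsOrd y → IsOrd (x ⊗ⱽ y)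
⊗ⱽ-isOrd x@(set A f) y@(set B g) ox oy = mex-isOrd _ λ (a , b) →
  let oa = elem-isOrd x ox a
      ob = elem-isOrd y oy b
  in ⊕ⱽ-isOrd _ _
       (⊕ⱽ-isOrd _ _ (⊗ⱽ-isOrd (f a) y oa oy) (⊗ⱽ-isOrd x (g b) ox ob))
       (⊗ⱽ-isOrd (f a) (g b) oa ob)

⊕ⱽ-cong : ∀ x x′ y y′ → x ≋ x′ → y ≋ y′ → x ⊕ⱽ y ≋ x′ ⊕ⱽ y′
⊕ⱽ-cong x@(set A f) x′@(set A′ f′) y@(set B g) y′@(set B′ g′) x≋@(p , q) y≋@(r , s) = mex-cong
  [ (λ a → let a′ , e = p a in inj₁ a′ , ⊕ⱽ-cong (f a) (f′ a′) y y′ e y≋)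
  , (λ b → let b′ , e = r b in inj₂ b′ , ⊕ⱽ-cong x x′ (g b) (g′ b′) x≋ e) ]
  [ (λ a′ → let a , e = q a′ in inj₁ a , ⊕ⱽ-cong (f a) (f′ a′) y y′ e y≋)
  , (λ b′ → let b , e = s b′ in inj₂ b , ⊕ⱽ-cong x x′ (g b) (g′ b′) x≋ e) ]

⊗ⱽ-cong : ∀ x x′ y y′ → x ≋ x′ → y ≋ y′ → x ⊗ⱽ y ≋ x′ ⊗ⱽ y′
⊗ⱽ-cong x@(set A f) x′@(set A′ f′) y@(set B g) y′@(set B′ g′) x≋@(p , q) y≋@(r , s) = mex-cong
  (λ (a , b) → let a′ , e = p a; b′ , e′ = r b in (a′ , b′) ,
    ⊕ⱽ-cong _ _ _ _
      (⊕ⱽ-cong _ _ _ _ (⊗ⱽ-cong (f a) (f′ a′) y y′ e y≋)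
                       (⊗ⱽ-cong x x′ (g b) (g′ b′) x≋ e′))
      (⊗ⱽ-cong (f a) (f′ a′) (g b) (g′ b′) e e′))
  (λ (a′ , b′) → let a , e = q a′; b , e′ = s b′ in (a , b) ,
    ⊕ⱽ-cong _ _ _ _
      (⊕ⱽ-cong _ _ _ _ (⊗ⱽ-cong (f a) (f′ a′) y y′ e y≋)
                       (⊗ⱽ-cong x x′ (g b) (g′ b′) x≋ e′))
      (⊗ⱽ-cong (f a) (f′ a′) (g b) (g′ b′) e e′))

-- Von Neumann ordinals: α < β is membership, so an ordinal is the set of
-- smaller ordinals.

record Ord : Set₁ where
  constructor ord
  field
    tree  : 𝕍
    isOrd : IsOrd tree

open Ord public

infix 4 _≈_ _≉_ _<_ _≤_

_≈_ _≉_ _<_ _≤_ : Ord → Ord → Set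
α ≈ β = tree α ≋ tree β
α ≉ β = ¬ (α ≈ β)
α < β = tree α ∈ tree β
α ≤ β = α < β ⊎ α ≈ β

_⊕_ _⊗_ : Ord → Ord → Ord
α ⊕ β = ord (tree α ⊕ⱽ tree β) (⊕ⱽ-isOrd _ _ (isOrd α) (isOrd β))
α ⊗ β = ord (tree α ⊗ⱽ tree β) (⊗ⱽ-isOrd _ _ (isOrd α) (isOrd β))

0ₒ 1ₒ : Ord
0ₒ = ord (set ⊥ λ ()) (mkIsOrd (λ _ _ ()) (λ _ ()))
1ₒ = ord (set ⊤ λ _ → tree 0ₒ)
  (mkIsOrd (λ y z (_ , e) z∈y → no y e z∈y) (λ y (_ , e) z w z∈y w∈z → no y e z∈y))
  where
  no : ∀ {z} {P : Set} y → y ≋ tree 0ₒ → z ∈ y → P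
  no y e z∈y with () ← proj₁ (∈-respʳ {y} e z∈y)

-- Minimality of μ is stated as: everything below μ is in S.

IsMex : ∀ {ℓ} → Pred Ord ℓ → Ord → Set (lsuc 0ℓ ⊔ˡ ℓ)
IsMex S μ = ¬ S μ × (∀ ν → ν < μ → S ν)

-- '⊕-isMex' and '⊗-isMex' are the recursive equations of Nim arithmetic, over
-- all smaller ordinals rather than over the branches of a tree.

private
  predecessor : (α : Ord) (i : Index (tree α)) → Σ[ α′ ∈ Ord ] α′ < α
  predecessor α i =
    ord (elem (tree α) i) (elem-isOrd _ (isOrd α) i) , elem-∈ (tree α) i

⊕-isMex : ∀ α β → IsMex
  (λ γ → (∃[ α′ ] α′ < α × γ ≈ α′ ⊕ β) ⊎ (∃[ β′ ] β′ < β × γ ≈ α ⊕ β′))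
  (α ⊕ β)
⊕-isMex α@(ord (set A f) _) β@(ord (set B g) _) =
  (λ { (inj₁ (α′ , (a , α′≋) , e)) →
         mex-∉ h (inj₁ a , ≋-trans e (⊕ⱽ-cong _ _ _ _ α′≋ (≋-refl {tree β})))
     ; (inj₂ (β′ , (b , β′≋) , e)) →
         mex-∉ h (inj₂ b , ≋-trans e (⊕ⱽ-cong _ _ _ _ (≋-refl {tree α}) β′≋)) }) ,
  λ ν ν< → options ν (mex-⊆ h ν<)
  where
  h : A ⊎ B → 𝕍
  h = [ (λ a → f a ⊕ⱽ tree β) , (λ b → tree α ⊕ⱽ g b) ]′

  options : ∀ ν → ∃[ i ] tree ν ≋ h i →
    (∃[ α′ ] α′ < α × ν ≈ α′ ⊕ β) ⊎ (∃[ β′ ] β′ < β × ν ≈ α ⊕ β′)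
  options ν (inj₁ a , e) = let α′ , lt = predecessor α a in inj₁ (α′ , lt , e)
  options ν (inj₂ b , e) = let β′ , lt = predecessor β b in inj₂ (β′ , lt , e)

⊗-isMex : ∀ α β → IsMex
  (λ γ → ∃[ α′ ] ∃[ β′ ] α′ < α × β′ < β ×
         γ ≈ (α′ ⊗ β) ⊕ (α ⊗ β′) ⊕ (α′ ⊗ β′))
  (α ⊗ β)
⊗-isMex α@(ord (set A f) _) β@(ord (set B g) _) =
  (λ { (α′ , β′ , (a , α′≋) , (b , β′≋) , e) →
         mex-∉ h ((a , b) , ≋-trans e
           (⊕ⱽ-cong _ _ _ _ (⊕ⱽ-cong _ _ _ _ (⊗ⱽ-cong _ _ _ _ α′≋ (≋-refl {tree β}))
                             (⊗ⱽ-cong _ _ _ _ (≋-refl {tree α}) β′≋))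
                    (⊗ⱽ-cong _ _ _ _ α′≋ β′≋))) }) ,
  λ { ν ν< → let (a , b) , e = mex-⊆ h ν<
                 α′ , lt = predecessor α a
                 β′ , lt′ = predecessor β b
             in α′ , β′ , lt , lt′ , e }
  where
  h : A × B → 𝕍
  h (a , b) = (f a ⊗ⱽ tree β) ⊕ⱽ (tree α ⊗ⱽ g b) ⊕ⱽ (f a ⊗ⱽ g b)

On₂ : RawSemiring (lsuc 0ℓ) 0ℓ
On₂ = record
  { Carrier = Ord ; _≈_ = _≈_ ; _+_ = _⊕_ ; _*_ = _⊗_ ; 0# = 0ₒ ; 1# = 1ₒ }

open RawSemiringDefinitions On₂ public using (sum; _^_)

↓_ : Ord → Pred Ord 0ℓ
(↓ u) α = α < u

record IsSubfield {ℓ} (F : Pred Ord ℓ) : Set (lsuc 0ℓ ⊔ˡ ℓ) where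
  field
    resp        : F Respects _≈_
    0∈          : F 0ₒ
    1∈          : F 1ₒ
    ⊕-closed    : ∀ {x y} → F x → F y → F (x ⊕ y)
    ⊗-closed    : ∀ {x y} → F x → F y → F (x ⊗ y)
    neg-closed  : ∀ {x} → F x → ∃[ y ] F y × x ⊕ y ≈ 0ₒ
    inv-closed  : ∀ {x} → F x → x ≉ 0ₒ → ∃[ y ] F y × x ⊗ y ≈ 1ₒ

IsFieldOrdinal : Ord → Set₁
IsFieldOrdinal u = IsSubfield (↓ u)

-- Nonzero polynomials only, indexed by their exact degree d; 'coeff i' is the
-- coefficient of Xⁱ.

record Polynomial {ℓ} (F : Pred Ord ℓ) (d : ℕ) : Set (lsuc 0ℓ ⊔ˡ ℓ) where
  field
    coeff     : Vector Ord (suc d)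
    coeff∈    : ∀ i → F (coeff i)
    leading≉0 : coeff (fromℕ d) ≉ 0ₒ

open Polynomial public

eval : ∀ {ℓ} {F : Pred Ord ℓ} {d} → Polynomial F d → Ord → Ord
eval p x = sum (λ i → coeff p i ⊗ (x ^ toℕ i))

IsRoot : ∀ {ℓ} {F : Pred Ord ℓ} {d} → Polynomial F d → Pred Ord 0ℓ
IsRoot p x = eval p x ≈ 0ₒ

AlgebraicClosure : Ord → Pred Ord (lsuc 0ℓ)
AlgebraicClosure u α = ∃[ d ] Σ[ p ∈ Polynomial (↓ u) d ] IsRoot p α

IsClosed : ∀ {ℓ} → ℕ → Pred Ord ℓ → Set (lsuc 0ℓ ⊔ˡ ℓ)
IsClosed n F = ∀ {d} → 1 ℕ.≤ d → d ℕ.≤ n → (p : Polynomial F d) → ∃[ x ] F x × IsRoot p x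

-- Classically the universe level allowed for F is immaterial: every class is
-- extensionally equal to one at any level.  Level 1 is that of AlgebraicClosure.

Closure : ℕ → Ord → Pred Ord (lsuc (lsuc 0ℓ))
Closure n u α = (F : Pred Ord (lsuc 0ℓ)) → IsSubfield F → IsClosed n F →
                ↓ u ⊆ F → F ⊆ AlgebraicClosure u → F α

-- An ordinal is identified with its set of predecessors.

_IsOrdinal_ : ∀ {ℓ} → Pred Ord ℓ → Ord → Set (lsuc 0ℓ ⊔ˡ ℓ)
P IsOrdinal α = P ≐ ↓ α

IsSup : ∀ {ℓ} → Pred Ord ℓ → Ord → Set (lsuc 0ℓ ⊔ˡ ℓ)
IsSup S σ = (∀ α → S α → α ≤ σ) × (∀ τ → (∀ α → S α → α ≤ τ) → σ ≤ τ)

module Submission where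

-- Conway's simplest extension theorems, in the following form.  Let v be the
-- least ordinal outside a class K closed under the field operations.  Then v is
-- a field ordinal: otherwise a least failing sum, product or inverse of elements
-- below v would equal v and put v in K.  If moreover v satisfies no equation of
-- degree at most n over v, then v is n-closed: for k at most n the values at v of
-- polynomials of degree < k are exactly the ordinals below v ^ k, hence options
-- of the k-fold product v ^ k, and this splits every monic polynomial of degree k.
--
-- Take for K the elements algebraic over u: since an element algebraic over K
-- lies in K, v is n-closed for all n, so it contains all algebraic elements and
-- equals ū.  Take for K the n-closure of u: an n-closed field contains every root
-- of its polynomials of degree at most n, so v is n-closed and equals the
-- n-closure.  Finally a root of a polynomial of degree d over u lies in the
-- d-closure.

open import Algebra.Bundles using (CommutativeMonoid; CommutativeSemiring; RawRing)
open import Algebra.Core using (Op₂)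
open import Algebra.Definitions using (Congruent₂)
import Algebra.Definitions.RawSemiring as RawSemiringDefinitions
import Algebra.Properties.Monoid.Sum as MonoidSum
import Algebra.Solver.CommutativeMonoid as CommutativeMonoidSolver
import Algebra.Solver.Ring as RingSolver
open import Algebra.Solver.Ring.AlmostCommutativeRing
  using (AlmostCommutativeRing; fromCommutativeSemiring; _-Raw-AlmostCommutative⟶_)
open import Axiom.ExcludedMiddle using (ExcludedMiddle)
open import Data.Bool.Base using (Bool; true; false; _∧_; _xor_)
open import Data.Empty using (⊥; ⊥-elim)
open import Data.Fin.Base using (zero; suc; toℕ; fromℕ; inject₁)
open import Data.Fin.Properties using (toℕ-fromℕ; toℕ-inject₁)
open import Data.List.Base using (List; []; _∷_; _++_; length; map)
open import Data.List.Relation.Unary.All using (All; []; _∷_)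
open import Data.Maybe.Base using (Maybe; nothing; just)
open import Data.Nat.Base as ℕ using (ℕ; zero; suc)
import Data.Nat.Properties as ℕ
open import Data.Product.Base using (∃-syntax; Σ-syntax; _×_; _,_; proj₁; proj₂)
open import Data.Sum.Base using (_⊎_; inj₁; inj₂; [_,_]′)
open import Data.Vec.Functional using (Vector)
open import Induction.WellFounded using (WellFounded; Acc; acc)
open import Level using (Level; 0ℓ; _⊔_; Lift; lift; lower) renaming (suc to lsuc)
open import Relation.Binary.Bundles using (Setoid)
open import Relation.Binary.Core using (Rel)
open import Relation.Binary.Definitions using (tri<; tri≈; tri>; _Respects_; Trichotomous)
open import Relation.Binary.PropositionalEquality.Core as ≡ using (_≡_)
import Relation.Binary.Reasoning.Setoid as SetoidReasoning
open import Relation.Binary.Structures using (IsStrictTotalOrder)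
open import Relation.Nullary.Decidable.Core using (yes; no; decidable-stable)
open import Relation.Nullary.Negation.Core using (¬_)
open import Relation.Unary using (Pred; _⊆_; U)

record NimArithmetic : Set₂ where
  infix 4 _≈_ _<_
  infixl 6 _+_
  infixl 7 _*_
  field
    Carrier : Set₁
    _≈_ _<_ : Rel Carrier 0ℓ
    _+_ _*_ : Op₂ Carrier
    0# 1#   : Carrier

    isStrictTotalOrder : IsStrictTotalOrder _≈_ _<_
    <-wellFounded      : WellFounded _<_
    0-minimal          : ∀ {x} → ¬ x < 0#
    0<1                : 0# < 1#
    <1⇒≈0              : ∀ {x} → x < 1# → x ≈ 0#

    +-cong      : Congruent₂ _≈_ _+_
    +-excludedˡ : ∀ {x x′ y} → x′ < x → ¬ x + y ≈ x′ + y
    +-excludedʳ : ∀ {x y y′} → y′ < y → ¬ x + y ≈ x + y′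
    +-option    : ∀ {x y z} → z < x + y →
                  (∃[ x′ ] x′ < x × z ≈ x′ + y) ⊎ (∃[ y′ ] y′ < y × z ≈ x + y′)

    *-cong      : Congruent₂ _≈_ _*_
    *-excluded  : ∀ {x x′ y y′} → x′ < x → y′ < y →
                  ¬ x * y ≈ x′ * y + x * y′ + x′ * y′
    *-option    : ∀ {x y z} → z < x * y →
                  ∃[ x′ ] ∃[ y′ ] x′ < x × y′ < y × z ≈ x′ * y + x * y′ + x′ * y′

module NimRing (N : NimArithmetic) where
  open NimArithmetic N public
  open IsStrictTotalOrder isStrictTotalOrder public
    using (compare; _≟_; irrefl; <-respˡ-≈; <-respʳ-≈; isEquivalence)
    renaming (trans to <-trans)
  open IsStrictTotalOrder isStrictTotalOrder using (module Eq)
  open Eq public using (refl; sym; trans)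

  setoid : Setoid (lsuc 0ℓ) 0ℓ
  setoid = record { isEquivalence = isEquivalence }

  open SetoidReasoning setoid

  infix 4 _≉_

  _≉_ : Rel Carrier 0ℓ
  x ≉ y = ¬ x ≈ y

  ≮∧≯⇒≈ : ∀ {x y} → ¬ x < y → ¬ y < x → x ≈ y
  ≮∧≯⇒≈ {x} {y} x≮y y≮x with compare x y
  ... | tri< x<y _ _ = ⊥-elim (x≮y x<y)
  ... | tri≈ _ x≈y _ = x≈y
  ... | tri> _ _ y<x = ⊥-elim (y≮x y<x)

  ≉0⇒0< : ∀ {x} → x ≉ 0# → 0# < x
  ≉0⇒0< {x} x≉0 with compare 0# x
  ... | tri< 0<x _ _ = 0<x
  ... | tri≈ _ 0≈x _ = ⊥-elim (x≉0 (sym 0≈x))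
  ... | tri> _ _ x<0 = ⊥-elim (0-minimal x<0)

  <⇒≉ : ∀ {x y} → x < y → y ≉ x
  <⇒≉ x<y y≈x = irrefl (sym y≈x) x<y

  +-congˡ : ∀ {x y z} → y ≈ z → x + y ≈ x + z
  +-congˡ = +-cong refl

  +-congʳ : ∀ {x y z} → y ≈ z → y + x ≈ z + x
  +-congʳ e = +-cong e refl

  *-congˡ : ∀ {x y z} → y ≈ z → x * y ≈ x * z
  *-congˡ = *-cong refl

  *-congʳ : ∀ {x y z} → y ≈ z → y * x ≈ z * x
  *-congʳ e = *-cong e refl

  +-cancelʳ : ∀ {x x′ y} → x + y ≈ x′ + y → x ≈ x′
  +-cancelʳ e = ≮∧≯⇒≈ (λ x<x′ → +-excludedˡ x<x′ (sym e)) (λ x′<x → +-excludedˡ x′<x e)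

  +-cancelˡ : ∀ {x y y′} → x + y ≈ x + y′ → y ≈ y′
  +-cancelˡ e = ≮∧≯⇒≈ (λ y<y′ → +-excludedʳ y<y′ (sym e)) (λ y′<y → +-excludedʳ y′<y e)

  private
    +-comm′ : ∀ {x y} → Acc _<_ x → Acc _<_ y → x + y ≈ y + x
    +-comm′ {x} {y} (acc rx) (acc ry) = ≮∧≯⇒≈
      (λ lt → [ (λ (y′ , y′<y , e) → +-excludedʳ y′<y (trans e (sym (+-comm′ (acc rx) (ry y′<y)))))
              , (λ (x′ , x′<x , e) → +-excludedˡ x′<x (trans e (sym (+-comm′ (rx x′<x) (acc ry)))))
              ]′ (+-option lt))
      (λ lt → [ (λ (x′ , x′<x , e) → +-excludedʳ x′<x (trans e (+-comm′ (rx x′<x) (acc ry))))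
              , (λ (y′ , y′<y , e) → +-excludedˡ y′<y (trans e (+-comm′ (acc rx) (ry y′<y))))
              ]′ (+-option lt))

    +-identityʳ′ : ∀ {x} → Acc _<_ x → x + 0# ≈ x
    +-identityʳ′ {x} (acc rx) = ≮∧≯⇒≈
      (λ lt → +-excludedˡ lt (sym (+-identityʳ′ (rx lt))))
      (λ lt → [ (λ (x′ , x′<x , e) → <⇒≉ x′<x (trans e (+-identityʳ′ (rx x′<x))))
              , (λ (_ , y′<0 , _) → 0-minimal y′<0)
              ]′ (+-option lt))

    x+x≈0′ : ∀ {x} → Acc _<_ x → x + x ≈ 0#
    x+x≈0′ {x} (acc rx) = ≮∧≯⇒≈ 0-minimal
      (λ lt → [ (λ (x′ , x′<x , e) → <⇒≉ x′<x (sym (+-cancelˡ (trans (x+x≈0′ (rx x′<x)) e))))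
              , (λ (x′ , x′<x , e) → <⇒≉ x′<x (sym (+-cancelʳ (trans (x+x≈0′ (rx x′<x)) e))))
              ]′ (+-option lt))

  +-comm : ∀ x y → x + y ≈ y + x
  +-comm x y = +-comm′ (<-wellFounded x) (<-wellFounded y)

  +-identityʳ : ∀ x → x + 0# ≈ x
  +-identityʳ x = +-identityʳ′ (<-wellFounded x)

  +-identityˡ : ∀ x → 0# + x ≈ x
  +-identityˡ x = trans (+-comm 0# x) (+-identityʳ x)

  x+x≈0 : ∀ x → x + x ≈ 0#
  x+x≈0 x = x+x≈0′ (<-wellFounded x)

  private
    +-assoc′ : ∀ {x y z} → Acc _<_ x → Acc _<_ y → Acc _<_ z → (x + y) + z ≈ x + (y + z)
    +-assoc′ {x} {y} {z} ax@(acc rx) ay@(acc ry) az@(acc rz) = ≮∧≯⇒≈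
      (λ lt → [ (λ (x′ , x′<x , e) → contraˣ x′<x e)
              , (λ (w , w<y+z , e) →
                  [ (λ (y′ , y′<y , e′) → contraʸ y′<y (trans e (+-congˡ e′)))
                  , (λ (z′ , z′<z , e′) → contraᶻ z′<z (trans e (+-congˡ e′)))
                  ]′ (+-option w<y+z))
              ]′ (+-option lt))
      (λ lt → [ (λ (w , w<x+y , e) →
                  [ (λ (x′ , x′<x , e′) → contraˣ′ x′<x (trans e (+-congʳ e′)))
                  , (λ (y′ , y′<y , e′) → contraʸ′ y′<y (trans e (+-congʳ e′)))
                  ]′ (+-option w<x+y))
              , (λ (z′ , z′<z , e) → contraᶻ′ z′<z e)
              ]′ (+-option lt))
      where
      contraˣ : ∀ {x′} → x′ < x → (x + y) + z ≉ x′ + (y + z)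
      contraˣ lt e = <⇒≉ lt (+-cancelʳ (+-cancelʳ (trans e (sym (+-assoc′ (rx lt) ay az)))))
      contraʸ : ∀ {y′} → y′ < y → (x + y) + z ≉ x + (y′ + z)
      contraʸ lt e = <⇒≉ lt (+-cancelˡ (+-cancelʳ (trans e (sym (+-assoc′ ax (ry lt) az)))))
      contraᶻ : ∀ {z′} → z′ < z → (x + y) + z ≉ x + (y + z′)
      contraᶻ lt e = <⇒≉ lt (+-cancelˡ (trans e (sym (+-assoc′ ax ay (rz lt)))))
      contraˣ′ : ∀ {x′} → x′ < x → x + (y + z) ≉ (x′ + y) + z
      contraˣ′ lt e = <⇒≉ lt (+-cancelʳ (trans e (+-assoc′ (rx lt) ay az)))
      contraʸ′ : ∀ {y′} → y′ < y → x + (y + z) ≉ (x + y′) + z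
      contraʸ′ lt e = <⇒≉ lt (+-cancelʳ (+-cancelˡ (trans e (+-assoc′ ax (ry lt) az))))
      contraᶻ′ : ∀ {z′} → z′ < z → x + (y + z) ≉ (x + y) + z′
      contraᶻ′ lt e = <⇒≉ lt (+-cancelˡ (+-cancelˡ (trans e (+-assoc′ ax ay (rz lt)))))

  +-assoc : ∀ x y z → (x + y) + z ≈ x + (y + z)
  +-assoc x y z = +-assoc′ (<-wellFounded x) (<-wellFounded y) (<-wellFounded z)

  +-commutativeMonoid : CommutativeMonoid (lsuc 0ℓ) 0ℓ
  +-commutativeMonoid = record
    { isCommutativeMonoid = record
      { isMonoid = record
        { isSemigroup = record
          { isMagma = record { isEquivalence = isEquivalence ; ∙-cong = +-cong }
          ; assoc = +-assoc }
        ; identity = +-identityˡ , +-identityʳ }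
      ; comm = +-comm } }

  private
    module + = CommutativeMonoidSolver +-commutativeMonoid
    open + using (solve; _⊜_; _⊕_)

  x+y≈0⇒x≈y : ∀ {x y} → x + y ≈ 0# → x ≈ y
  x+y≈0⇒x≈y e = +-cancelʳ (trans e (sym (x+x≈0 _)))

  y+[y+x]≈x : ∀ x y → y + (y + x) ≈ x
  y+[y+x]≈x x y = begin
    y + (y + x)  ≈⟨ +-assoc y y x ⟨
    y + y + x    ≈⟨ +-congʳ (x+x≈0 y) ⟩
    0# + x       ≈⟨ +-identityˡ x ⟩
    x            ∎

  x≈y+z⇒y≈x+z : ∀ {x y z} → x ≈ y + z → y ≈ x + z
  x≈y+z⇒y≈x+z {x} {y} {z} e = begin
    y            ≈⟨ y+[y+x]≈x y z ⟨
    z + (z + y)  ≈⟨ solve 2 (λ z y → z ⊕ (z ⊕ y) ⊜ (y ⊕ z) ⊕ z) refl z y ⟩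
    y + z + z    ≈⟨ +-congʳ e ⟨
    x + z        ∎

  *-separates : ∀ {x x′ y y′} → x ≉ x′ → y ≉ y′ → x * y ≉ x′ * y + x * y′ + x′ * y′
  *-separates {x} {x′} {y} {y′} x≉x′ y≉y′ e with compare x x′ | compare y y′
  ... | tri≈ _ x≈x′ _ | _            = x≉x′ x≈x′
  ... | tri< _ _ _ | tri≈ _ y≈y′ _   = y≉y′ y≈y′
  ... | tri> _ _ _ | tri≈ _ y≈y′ _   = y≉y′ y≈y′
  ... | tri> _ _ x′<x | tri> _ _ y′<y = *-excluded x′<x y′<y e
  ... | tri< x<x′ _ _ | tri< y<y′ _ _ = *-excluded x<x′ y<y′
    (trans (x≈y+z⇒y≈x+z (trans e (+-comm _ _)))
           (solve 3 (λ a b c → a ⊕ (b ⊕ c) ⊜ (c ⊕ b) ⊕ a) refl _ _ _))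
  ... | tri< x<x′ _ _ | tri> _ _ y′<y = *-excluded x<x′ y′<y
    (trans (x≈y+z⇒y≈x+z (trans e (+-assoc _ _ _)))
           (solve 3 (λ a b c → a ⊕ (b ⊕ c) ⊜ (a ⊕ c) ⊕ b) refl _ _ _))
  ... | tri> _ _ x′<x | tri< y<y′ _ _ = *-excluded x′<x y<y′
    (trans (x≈y+z⇒y≈x+z (trans e (solve 3 (λ a b c → (a ⊕ b) ⊕ c ⊜ b ⊕ (a ⊕ c)) refl _ _ _)))
           (solve 3 (λ a b c → a ⊕ (b ⊕ c) ⊜ (c ⊕ a) ⊕ b) refl _ _ _))

  private
    *-comm′ : ∀ {x y} → Acc _<_ x → Acc _<_ y → x * y ≈ y * x
    *-comm′ {x} {y} (acc rx) (acc ry) = ≮∧≯⇒≈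
      (λ lt → let y′ , x′ , y′<y , x′<x , e = *-option lt in *-excluded x′<x y′<y (begin
         x * y                        ≈⟨ e ⟩
         y′ * x + y * x′ + y′ * x′    ≈⟨ +-cong (+-comm _ _) (sym (*-comm′ (rx x′<x) (ry y′<y))) ⟩
         y * x′ + y′ * x + x′ * y′
           ≈⟨ +-congʳ (+-cong (sym (*-comm′ (rx x′<x) (acc ry))) (sym (*-comm′ (acc rx) (ry y′<y)))) ⟩
         x′ * y + x * y′ + x′ * y′    ∎))
      (λ lt → let x′ , y′ , x′<x , y′<y , e = *-option lt in *-excluded y′<y x′<x (begin
         y * x                        ≈⟨ e ⟩
         x′ * y + x * y′ + x′ * y′    ≈⟨ +-cong (+-comm _ _) (*-comm′ (rx x′<x) (ry y′<y)) ⟩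
         x * y′ + x′ * y + y′ * x′
           ≈⟨ +-congʳ (+-cong (*-comm′ (acc rx) (ry y′<y)) (*-comm′ (rx x′<x) (acc ry))) ⟩
         y′ * x + y * x′ + y′ * x′    ∎))

    *-zeroˡ : ∀ x → 0# * x ≈ 0#
    *-zeroˡ x = ≮∧≯⇒≈ 0-minimal (λ lt → let _ , _ , x′<0 , _ = *-option lt in 0-minimal x′<0)

    *-zeroʳ : ∀ x → x * 0# ≈ 0#
    *-zeroʳ x = ≮∧≯⇒≈ 0-minimal (λ lt → let _ , _ , _ , x′<0 , _ = *-option lt in 0-minimal x′<0)

    1*-option : ∀ x x′ → 0# * x + 1# * x′ + 0# * x′ ≈ 1# * x′
    1*-option x x′ = begin
      0# * x + 1# * x′ + 0# * x′  ≈⟨ +-cong (+-congʳ (*-zeroˡ x)) (*-zeroˡ x′) ⟩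
      0# + 1# * x′ + 0#           ≈⟨ solve 1 (λ a → (+.id ⊕ a) ⊕ +.id ⊜ a) refl _ ⟩
      1# * x′                     ∎

    *-identityˡ′ : ∀ {x} → Acc _<_ x → 1# * x ≈ x
    *-identityˡ′ {x} (acc rx) = ≮∧≯⇒≈
      (λ lt → *-excluded 0<1 lt (sym (trans (1*-option x _) (*-identityˡ′ (rx lt)))))
      (λ lt → let o , x′ , o<1 , x′<x , e = *-option lt in <⇒≉ x′<x (begin
         x                          ≈⟨ e ⟩
         o * x + 1# * x′ + o * x′
           ≈⟨ +-cong (+-congʳ (*-congʳ (<1⇒≈0 o<1))) (*-congʳ (<1⇒≈0 o<1)) ⟩
         0# * x + 1# * x′ + 0# * x′ ≈⟨ 1*-option x x′ ⟩
         1# * x′                    ≈⟨ *-identityˡ′ (rx x′<x) ⟩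
         x′                         ∎))

  *-comm : ∀ x y → x * y ≈ y * x
  *-comm x y = *-comm′ (<-wellFounded x) (<-wellFounded y)

  *-identityˡ : ∀ x → 1# * x ≈ x
  *-identityˡ x = *-identityˡ′ (<-wellFounded x)

  private
    cancel-middle : ∀ a b c d e → (a + d) + (b + e) + (c + d) ≈ (a + b + c) + e
    cancel-middle a b c d e = begin
      (a + d) + (b + e) + (c + d)
        ≈⟨ solve 5 (λ a b c d e → ((a ⊕ d) ⊕ (b ⊕ e)) ⊕ (c ⊕ d)
                       ⊜ ((a ⊕ b) ⊕ c ⊕ e) ⊕ (d ⊕ d)) refl a b c d e ⟩
      (a + b + (c + e)) + (d + d)  ≈⟨ +-congˡ (x+x≈0 d) ⟩
      (a + b + (c + e)) + 0#
        ≈⟨ solve 4 (λ a b c e → ((a ⊕ b) ⊕ (c ⊕ e)) ⊕ +.id ⊜ ((a ⊕ b) ⊕ c) ⊕ e) refl a b c e ⟩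
      (a + b + c) + e              ∎

    *-distribˡ′ : ∀ {x y z} → Acc _<_ x → Acc _<_ y → Acc _<_ z → x * (y + z) ≈ x * y + x * z
    *-distribˡ′ {x} {y} {z} ax@(acc rx) ay@(acc ry) az@(acc rz) = ≮∧≯⇒≈
      (λ lt → [ (λ (w , w<xy , e) → let x′ , y′ , x′<x , y′<y , e′ = *-option w<xy in
                  *-separates (<⇒≉ x′<x) (λ e″ → <⇒≉ y′<y (+-cancelʳ e″))
                    (trans e (trans (+-congʳ e′) (sym (expandʸ x′<x y′<y)))))
              , (λ (w , w<xz , e) → let x′ , z′ , x′<x , z′<z , e′ = *-option w<xz in
                  *-separates (<⇒≉ x′<x) (λ e″ → <⇒≉ z′<z (+-cancelˡ e″))
                    (trans e (trans (+-comm _ _) (trans (+-congʳ e′) (sym (expandᶻ x′<x z′<z))))))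
              ]′ (+-option lt))
      (λ lt → let x′ , t , x′<x , t<y+z , e = *-option lt in
        [ (λ (y′ , y′<y , e′) → *-excluded x′<x y′<y
             (+-cancelʳ (trans e (trans (congᵗ e′) (expandʸ x′<x y′<y)))))
        , (λ (z′ , z′<z , e′) → *-excluded x′<x z′<z
             (+-cancelʳ (trans (+-comm _ _) (trans e (trans (congᵗ e′) (expandᶻ x′<x z′<z))))))
        ]′ (+-option t<y+z))
      where
      congᵗ : ∀ {x′ t s} → t ≈ s →
        x′ * (y + z) + x * t + x′ * t ≈ x′ * (y + z) + x * s + x′ * s
      congᵗ e = +-cong (+-congˡ (*-congˡ e)) (*-congˡ e)

      expandʸ : ∀ {x′ y′} → x′ < x → y′ < y →
        x′ * (y + z) + x * (y′ + z) + x′ * (y′ + z) ≈ (x′ * y + x * y′ + x′ * y′) + x * z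
      expandʸ {x′} {y′} x′<x y′<y = trans
        (+-cong (+-cong (*-distribˡ′ (rx x′<x) ay az) (*-distribˡ′ ax (ry y′<y) az))
                (*-distribˡ′ (rx x′<x) (ry y′<y) az))
        (cancel-middle _ _ _ _ _)

      expandᶻ : ∀ {x′ z′} → x′ < x → z′ < z →
        x′ * (y + z) + x * (y + z′) + x′ * (y + z′) ≈ (x′ * z + x * z′ + x′ * z′) + x * y
      expandᶻ {x′} {z′} x′<x z′<z = trans
        (+-cong (+-cong (flip (*-distribˡ′ (rx x′<x) ay az)) (flip (*-distribˡ′ ax ay (rz z′<z))))
                (flip (*-distribˡ′ (rx x′<x) ay (rz z′<z))))
        (cancel-middle _ _ _ _ _)
        where
        flip : ∀ {a b c} → a ≈ b + c → a ≈ c + b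
        flip e = trans e (+-comm _ _)

  *-distribˡ-+ : ∀ x y z → x * (y + z) ≈ x * y + x * z
  *-distribˡ-+ x y z = *-distribˡ′ (<-wellFounded x) (<-wellFounded y) (<-wellFounded z)

  *-distribʳ-+ : ∀ x y z → (y + z) * x ≈ y * x + z * x
  *-distribʳ-+ x y z = begin
    (y + z) * x    ≈⟨ *-comm _ x ⟩
    x * (y + z)    ≈⟨ *-distribˡ-+ x y z ⟩
    x * y + x * z  ≈⟨ +-cong (*-comm x y) (*-comm x z) ⟩
    y * x + z * x  ∎

  private
    distribˡ₃ : ∀ x a b c → x * (a + b + c) ≈ x * a + x * b + x * c
    distribˡ₃ x a b c = trans (*-distribˡ-+ x _ c) (+-congʳ (*-distribˡ-+ x a b))

    distribʳ₃ : ∀ x a b c → (a + b + c) * x ≈ a * x + b * x + c * x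
    distribʳ₃ x a b c = trans (*-distribʳ-+ x _ c) (+-congʳ (*-distribʳ-+ x a b))

    *-assoc′ : ∀ {x y z} → Acc _<_ x → Acc _<_ y → Acc _<_ z → (x * y) * z ≈ x * (y * z)
    *-assoc′ {x} {y} {z} ax@(acc rx) ay@(acc ry) az@(acc rz) = ≮∧≯⇒≈
      (λ lt → let x′ , w , x′<x , w<yz , e = *-option lt
                  y′ , z′ , y′<y , z′<z , e′ = *-option w<yz
              in *-separates (*-excluded x′<x y′<y) (<⇒≉ z′<z) (begin
                (x * y) * z                       ≈⟨ e ⟩
                x′ * (y * z) + x * w + x′ * w
                  ≈⟨ +-cong (+-congˡ (*-congˡ e′)) (*-congˡ e′) ⟩
                _                                 ≈⟨ options x′<x y′<y z′<z ⟨
                _                                 ∎))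
      (λ lt → let w , z′ , w<xy , z′<z , e = *-option lt
                  x′ , y′ , x′<x , y′<y , e′ = *-option w<xy
              in *-separates (<⇒≉ x′<x) (*-excluded y′<y z′<z) (begin
                x * (y * z)                       ≈⟨ e ⟩
                w * z + (x * y) * z′ + w * z′
                  ≈⟨ +-cong (+-congʳ (*-congʳ e′)) (*-congʳ e′) ⟩
                _                                 ≈⟨ options x′<x y′<y z′<z ⟩
                _                                 ∎))
      where
      options : ∀ {x′ y′ z′} → x′ < x → y′ < y → z′ < z →
        let xy = x′ * y + x * y′ + x′ * y′
            yz = y′ * z + y * z′ + y′ * z′
        in xy * z + (x * y) * z′ + xy * z′ ≈ x′ * (y * z) + x * yz + x′ * yz
      options {x′} {y′} {z′} x′<x y′<y z′<z = begin
        _ ≈⟨ +-cong (+-congʳ (distribʳ₃ z _ _ _)) (distribʳ₃ z′ _ _ _) ⟩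
        ((x′ * y) * z + (x * y′) * z + (x′ * y′) * z) + (x * y) * z′
          + ((x′ * y) * z′ + (x * y′) * z′ + (x′ * y′) * z′)
          ≈⟨ +-cong (+-cong (+-cong (+-cong (*-assoc′ (rx x′<x) ay az) (*-assoc′ ax (ry y′<y) az))
                                   (*-assoc′ (rx x′<x) (ry y′<y) az))
                           (*-assoc′ ax ay (rz z′<z)))
                   (+-cong (+-cong (*-assoc′ (rx x′<x) ay (rz z′<z)) (*-assoc′ ax (ry y′<y) (rz z′<z)))
                           (*-assoc′ (rx x′<x) (ry y′<y) (rz z′<z))) ⟩
        (x′ * (y * z) + x * (y′ * z) + x′ * (y′ * z)) + x * (y * z′)
          + (x′ * (y * z′) + x * (y′ * z′) + x′ * (y′ * z′))
          ≈⟨ solve 7 (λ a b c d e f g → (((a ⊕ b) ⊕ c) ⊕ d) ⊕ ((e ⊕ f) ⊕ g)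
                                      ⊜ (a ⊕ ((b ⊕ d) ⊕ f)) ⊕ ((c ⊕ e) ⊕ g)) refl _ _ _ _ _ _ _ ⟩
        x′ * (y * z) + (x * (y′ * z) + x * (y * z′) + x * (y′ * z′))
          + (x′ * (y′ * z) + x′ * (y * z′) + x′ * (y′ * z′))
          ≈⟨ +-cong (+-congˡ (distribˡ₃ x _ _ _)) (distribˡ₃ x′ _ _ _) ⟨
        _ ∎

  *-assoc : ∀ x y z → (x * y) * z ≈ x * (y * z)
  *-assoc x y z = *-assoc′ (<-wellFounded x) (<-wellFounded y) (<-wellFounded z)

  commutativeSemiring : CommutativeSemiring (lsuc 0ℓ) 0ℓ
  commutativeSemiring = record
    { isCommutativeSemiring = record
      { isSemiring = record
        { isSemiringWithoutAnnihilatingZero = record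
          { +-isCommutativeMonoid = CommutativeMonoid.isCommutativeMonoid +-commutativeMonoid
          ; *-cong = *-cong
          ; *-assoc = *-assoc
          ; *-identity = *-identityˡ , λ x → trans (*-comm x 1#) (*-identityˡ x)
          ; distrib = *-distribˡ-+ , *-distribʳ-+ }
        ; zero = *-zeroˡ , *-zeroʳ }
      ; *-comm = *-comm } }

  x*y≈0⇒x≈0⊎y≈0 : ∀ {x y} → x * y ≈ 0# → x ≈ 0# ⊎ y ≈ 0#
  x*y≈0⇒x≈0⊎y≈0 {x} {y} e with x ≟ 0# | y ≟ 0#
  ... | yes x≈0 | _       = inj₁ x≈0
  ... | no _    | yes y≈0 = inj₂ y≈0
  ... | no x≉0  | no y≉0  = ⊥-elim (*-separates x≉0 y≉0 (begin
    x * y                       ≈⟨ e ⟩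
    0#                          ≈⟨ solve 0 (+.id ⊜ (+.id ⊕ +.id) ⊕ +.id) refl ⟩
    0# + 0# + 0#                ≈⟨ +-cong (+-cong (*-zeroˡ y) (*-zeroʳ x)) (*-zeroˡ 0#) ⟨
    0# * y + x * 0# + 0# * 0#   ∎))

module NimPolynomials (N : NimArithmetic) where
  open NimRing N public
  open CommutativeSemiring commutativeSemiring public
    using (rawSemiring; *-identityʳ) renaming (zeroˡ to *-zeroˡ; zeroʳ to *-zeroʳ)
  open CommutativeSemiring commutativeSemiring using (+-monoid)
  open RawSemiringDefinitions rawSemiring public using (_^_; sum)
  open MonoidSum +-monoid using (sum-init-last)
  open SetoidReasoning setoid

  private
    almostCommutativeRing : AlmostCommutativeRing (lsuc 0ℓ) 0ℓ
    almostCommutativeRing = fromCommutativeSemiring commutativeSemiring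

    𝔽₂ : RawRing 0ℓ 0ℓ
    𝔽₂ = record
      { Carrier = Bool ; _≈_ = _≡_ ; _+_ = _xor_ ; _*_ = _∧_ ; -_ = λ b → b
      ; 0# = false ; 1# = true }

    ⟦_⟧₂ : Bool → Carrier
    ⟦ false ⟧₂ = 0#
    ⟦ true  ⟧₂ = 1#

    ⟦⟧₂-+ : ∀ a b → ⟦ a xor b ⟧₂ ≈ ⟦ a ⟧₂ + ⟦ b ⟧₂
    ⟦⟧₂-+ false b     = sym (+-identityˡ _)
    ⟦⟧₂-+ true  false = sym (+-identityʳ _)
    ⟦⟧₂-+ true  true  = sym (x+x≈0 _)

    ⟦⟧₂-* : ∀ a b → ⟦ a ∧ b ⟧₂ ≈ ⟦ a ⟧₂ * ⟦ b ⟧₂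
    ⟦⟧₂-* false b = sym (*-zeroˡ _)
    ⟦⟧₂-* true  b = sym (*-identityˡ _)

    𝔽₂⟶On₂ : 𝔽₂ -Raw-AlmostCommutative⟶ almostCommutativeRing
    𝔽₂⟶On₂ = record
      { ⟦_⟧ = ⟦_⟧₂ ; +-homo = ⟦⟧₂-+ ; *-homo = ⟦⟧₂-* ; -‿homo = λ _ → refl
      ; 0-homo = refl ; 1-homo = refl }

    _≟₂_ : ∀ a b → Maybe (⟦ a ⟧₂ ≈ ⟦ b ⟧₂)
    false ≟₂ false = just refl
    true  ≟₂ true  = just refl
    _     ≟₂ _     = nothing

  -- Coefficients in 𝔽₂ make the solver cancel x + x.
  module 𝔽₂-Solver = RingSolver 𝔽₂ almostCommutativeRing 𝔽₂⟶On₂ _≟₂_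

  open 𝔽₂-Solver using (solve; _:=_; _:+_; _:*_; con)

  private
    variable
      ℓ : Level
      F G : Pred Carrier ℓ
      f g : Carrier → Carrier
      x y z : Carrier
      k n : ℕ

  record IsSubring {ℓ} (F : Pred Carrier ℓ) : Set (lsuc 0ℓ ⊔ ℓ) where
    field
      resp     : F Respects _≈_
      0∈       : F 0#
      1∈       : F 1#
      +-closed : F x → F y → F (x + y)
      *-closed : F x → F y → F (x * y)

    ^-closed : F x → ∀ k → F (x ^ k)
    ^-closed x∈ zero    = 1∈
    ^-closed x∈ (suc k) = *-closed x∈ (^-closed x∈ k)

  record IsSubfield {ℓ} (F : Pred Carrier ℓ) : Set (lsuc 0ℓ ⊔ ℓ) where
    field
      isSubring : IsSubring F
      inverse   : F x → x ≉ 0# → ∃[ y ] F y × x * y ≈ 1#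

    open IsSubring isSubring public

  data PolyBelow (F : Pred Carrier ℓ) : ℕ → (Carrier → Carrier) → Set (lsuc 0ℓ ⊔ ℓ) where
    zero : (∀ x → f x ≈ 0#) → PolyBelow F 0 f
    suc  : ∀ {c} → F c → PolyBelow F k g → (∀ x → f x ≈ c * x ^ k + g x) → PolyBelow F (suc k) f

  data PolyOfDegree (F : Pred Carrier ℓ) (k : ℕ) (f : Carrier → Carrier) : Set (lsuc 0ℓ ⊔ ℓ) where
    poly : ∀ {c} → F c → c ≉ 0# → PolyBelow F k g → (∀ x → f x ≈ c * x ^ k + g x) →
           PolyOfDegree F k f

  polyBelow-mono : F ⊆ G → PolyBelow F k f → PolyBelow G k f
  polyBelow-mono F⊆G (zero e)     = zero e
  polyBelow-mono F⊆G (suc c∈ p e) = suc (F⊆G c∈) (polyBelow-mono F⊆G p) e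

  polyOfDegree-mono : F ⊆ G → PolyOfDegree F k f → PolyOfDegree G k f
  polyOfDegree-mono F⊆G (poly c∈ c≉0 p e) = poly (F⊆G c∈) c≉0 (polyBelow-mono F⊆G p) e

  polyOfDegree-0-noRoot : PolyOfDegree F 0 f → f x ≉ 0#
  polyOfDegree-0-noRoot {f = f} {x = x} (poly {g = g} {c} _ c≉0 (zero g≈0) e) fx≈0 = c≉0 (begin
    c             ≈⟨ solve 1 (λ c → c := c :* con true :+ con false) refl c ⟩
    c * 1# + 0#   ≈⟨ +-congˡ (g≈0 x) ⟨
    c * 1# + g x  ≈⟨ e x ⟨
    f x           ≈⟨ fx≈0 ⟩
    0#            ∎)

  module _ {F : Pred Carrier ℓ} (F-isSubring : IsSubring F) where
    open IsSubring F-isSubring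

    polyBelow-suc : PolyBelow F k f → PolyBelow F (suc k) f
    polyBelow-suc {k = k} p = suc 0∈ p λ x → solve 2 (λ X y → y
                                                         := con false :* X :+ y) refl (x ^ k) _

    polyBelow-0 : ∀ k → PolyBelow F k (λ _ → 0#)
    polyBelow-0 zero    = zero λ _ → refl
    polyBelow-0 (suc k) = polyBelow-suc (polyBelow-0 k)

    polyBelow-const : F z → ∀ k → PolyBelow F (suc k) (λ _ → z)
    polyBelow-const z∈ zero    =
      suc z∈ (polyBelow-0 0) λ _ → solve 1 (λ z → z := z :* con true :+ con false) refl _
    polyBelow-const z∈ (suc k) = polyBelow-suc (polyBelow-const z∈ k)

    polyBelow-+ : PolyBelow F k f → PolyBelow F k g → PolyBelow F k (λ x → f x + g x)
    polyBelow-+ (zero e)      (zero e′)      =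
      zero λ x → trans (+-cong (e x) (e′ x)) (+-identityˡ 0#)
    polyBelow-+ (suc {k = k} c∈ p e) (suc c′∈ p′ e′) = suc (+-closed c∈ c′∈) (polyBelow-+ p p′)
      λ x → trans (+-cong (e x) (e′ x))
        (solve 5 (λ c c′ X g g′ → (c :* X :+ g) :+ (c′ :* X :+ g′) := (c :+ c′) :* X :+ (g :+ g′))
               refl _ _ (x ^ k) _ _)

    polyBelow-scale : F z → PolyBelow F k f → PolyBelow F k (λ x → z * f x)
    polyBelow-scale z∈ (zero e)     = zero λ x → trans (*-congˡ (e x)) (*-zeroʳ _)
    polyBelow-scale z∈ (suc {k = k} c∈ p e) = suc (*-closed z∈ c∈) (polyBelow-scale z∈ p)
      λ x → trans (*-congˡ (e x))
        (solve 4 (λ z c X g → z :* (c :* X :+ g) := z :* c :* X :+ z :* g) refl _ _ (x ^ k) _)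

    polyBelow-shift : PolyBelow F k f → PolyBelow F (suc k) (λ x → x * f x)
    polyBelow-shift (zero e)     = suc 0∈ (polyBelow-0 0) λ x → trans (*-congˡ (e x))
      (solve 1 (λ x → x :* con false := con false :* con true :+ con false) refl x)
    polyBelow-shift (suc {k = k} c∈ p e) = suc c∈ (polyBelow-shift p) λ x → trans (*-congˡ (e x))
      (solve 4 (λ x c X g → x :* (c :* X :+ g) := c :* (x :* X) :+ x :* g) refl x _ (x ^ k) _)

    polyBelow-closed : PolyBelow F k f → F x → F (f x)
    polyBelow-closed (zero e)             x∈ = resp (sym (e _)) 0∈
    polyBelow-closed (suc {k = k} c∈ p e) x∈ = resp (sym (e _))
      (+-closed (*-closed c∈ (^-closed x∈ k)) (polyBelow-closed p x∈))

    polyOfDegree-closed : PolyOfDegree F k f → F x → F (f x)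
    polyOfDegree-closed (poly c∈ _ p e) = polyBelow-closed (suc c∈ p e)

    private
      geometric : F y → ∀ k → ∃[ g ] PolyBelow F k g ×
                  (∀ x → x ^ suc k ≈ y ^ suc k + (x + y) * (x ^ k + g x))
      geometric {y} y∈ zero = (λ _ → 0#) , polyBelow-0 0 , λ x →
        solve 2 (λ x y → x :* con true
                    := y :* con true :+ (x :+ y) :* (con true :+ con false)) refl x y
      geometric {y} y∈ (suc k) = let g , p , e = geometric y∈ k in
        (λ x → x * g x + y ^ suc k) ,
        polyBelow-+ (polyBelow-shift p) (polyBelow-const (^-closed y∈ (suc k)) k) ,
        λ x → trans (*-congˡ (e x))
          (solve 5 (λ x y Y X g → x :* (Y :+ (x :+ y) :* (X :+ g))
                                := y :* Y :+ (x :+ y) :* (x :* X :+ (x :* g :+ Y)))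
                 refl x y (y ^ suc k) (x ^ k) (g x))

    private
      -- The remainder h below the leading term is itself a polynomial with a
      -- (possibly zero) leading coefficient, so no case distinction is needed.
      quotient : ∀ {c} → F y → F c → PolyBelow F (suc k) f →
        ∃[ g ] PolyBelow F k g ×
        (∀ x → c * x ^ suc k + f x ≈ (c * y ^ suc k + f y) + (x + y) * (c * x ^ k + g x))
      quotient {y = y} {k = zero} {f} {c} y∈ c∈ (suc {c = d} _ (zero g≈0) e) =
        (λ _ → 0#) , polyBelow-0 0 , λ x → begin
          c * (x * 1#) + f x           ≈⟨ +-congˡ (const x) ⟩
          c * (x * 1#) + d
            ≈⟨ solve 4 (λ c x y d → c :* (x :* con true) :+ d
                 := (c :* (y :* con true) :+ d) :+ (x :+ y) :* (c :* con true :+ con false))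
                 refl c x y d ⟩
          (c * (y * 1#) + d) + (x + y) * (c * 1# + 0#)    ≈⟨ +-congʳ (+-congˡ (const y)) ⟨
          (c * (y * 1#) + f y) + (x + y) * (c * 1# + 0#)  ∎
        where
        const : ∀ x → f x ≈ d
        const x = trans (e x) (trans (+-congˡ (g≈0 x))
          (solve 1 (λ d → d :* con true :+ con false := d) refl d))
      quotient {y = y} {k = suc k} {f} {c} y∈ c∈ (suc {g = h} {c = d} d∈ p e) =
        let g  , q  , e′ = quotient y∈ d∈ p
            g′ , q′ , e″ = geometric y∈ (suc k)
            Y = y ^ suc (suc k)
        in (λ x → c * g′ x + (d * x ^ k + g x)) ,
           polyBelow-+ (polyBelow-scale c∈ q′) (suc d∈ q λ _ → refl) , λ x → begin
             c * x ^ suc (suc k) + f x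
               ≈⟨ +-cong (*-congˡ (e″ x)) (trans (e x) (trans (e′ x) (+-congʳ (sym (e y))))) ⟩
             c * (Y + (x + y) * (x ^ suc k + g′ x)) + (f y + (x + y) * (d * x ^ k + g x))
               ≈⟨ solve 7 (λ c Y u X g′ fy g → c :* (Y :+ u :* (X :+ g′)) :+ (fy :+ u :* g)
                                         := (c :* Y :+ fy) :+ u :* (c :* X :+ (c :* g′ :+ g)))
                        refl c Y (x + y) (x ^ suc k) (g′ x) (f y) (d * x ^ k + g x) ⟩
             (c * Y + f y) + (x + y) * (c * x ^ suc k + (c * g′ x + (d * x ^ k + g x)))  ∎

    factor : F y → PolyOfDegree F (suc k) f →
             ∃[ g ] PolyOfDegree F k g × (∀ x → f x ≈ f y + (x + y) * g x)
    factor {y = y} {k} y∈ (poly {c = c} c∈ c≉0 p e) = let g , q , e′ = quotient y∈ c∈ p in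
      (λ x → c * x ^ k + g x) , poly c∈ c≉0 q (λ _ → refl) ,
      λ x → trans (e x) (trans (e′ x) (+-congʳ (sym (e y))))

    factor-root : F y → f y ≈ 0# → PolyOfDegree F (suc k) f →
                  ∃[ g ] PolyOfDegree F k g × (∀ {x} → f x ≈ 0# → x ≈ y ⊎ g x ≈ 0#)
    factor-root {y = y} {f = f} y∈ fy≈0 p = let g , q , e = factor y∈ p in g , q , λ {x} fx≈0 →
      [ (λ x+y≈0 → inj₁ (x+y≈0⇒x≈y x+y≈0)) , inj₂ ]′ (x*y≈0⇒x≈0⊎y≈0 (begin
        (x + y) * g x          ≈⟨ +-identityˡ _ ⟨
        0# + (x + y) * g x     ≈⟨ +-congʳ fy≈0 ⟨
        f y + (x + y) * g x    ≈⟨ e x ⟨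
        f x                    ≈⟨ fx≈0 ⟩
        0#                     ∎))

  IsClosed : ℕ → Pred Carrier ℓ → Set (lsuc 0ℓ ⊔ ℓ)
  IsClosed n F = ∀ {k f} → 1 ℕ.≤ k → k ℕ.≤ n → PolyOfDegree F k f → ∃[ x ] F x × f x ≈ 0#

  isClosed⇒root∈ : IsSubring F → IsClosed n F → k ℕ.≤ n → PolyOfDegree F k f → f x ≈ 0# → F x
  isClosed⇒root∈ {k = zero} R closed k≤n p fx≈0 = ⊥-elim (polyOfDegree-0-noRoot p fx≈0)
  isClosed⇒root∈ {k = suc k} R closed k≤n p fx≈0 =
    let y , y∈ , fy≈0 = closed (ℕ.s≤s ℕ.z≤n) k≤n p
        g , q , split = factor-root R y∈ fy≈0 p
    in [ (λ x≈y → IsSubring.resp R (sym x≈y) y∈)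
       , isClosed⇒root∈ R closed (ℕ.<⇒≤ k≤n) q
       ]′ (split fx≈0)

  finitelyManyRoots : ExcludedMiddle (lsuc 0ℓ) → PolyOfDegree U k f →
                      Σ[ r ∈ (ℕ → Carrier) ] (∀ {x} → f x ≈ 0# → ∃[ i ] x ≈ r i)
  finitelyManyRoots {zero} em p = (λ _ → 0#) , λ fx≈0 → ⊥-elim (polyOfDegree-0-noRoot p fx≈0)
  finitelyManyRoots {suc k} {f} em p with em {∃[ y ] f y ≈ 0#}
  ... | no ¬root       = (λ _ → 0#) , λ fx≈0 → ⊥-elim (¬root (_ , fx≈0))
  ... | yes (y , fy≈0) =
    let g , q , split = factor-root U-isSubring _ fy≈0 p
        r , covers    = finitelyManyRoots em q
    in (λ { zero → y ; (suc i) → r i }) , λ fx≈0 →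
       [ (λ x≈y → 0 , x≈y) , (λ gx≈0 → let i , e = covers gx≈0 in suc i , e) ]′ (split fx≈0)
    where
    U-isSubring : IsSubring U
    U-isSubring = record
      { resp = λ _ _ → _ ; 0∈ = _ ; 1∈ = _ ; +-closed = λ _ _ → _ ; *-closed = λ _ _ → _ }

  private
    snoc : ∀ {n} → Vector Carrier n → Carrier → Vector Carrier (suc n)
    snoc {zero}  c a _       = a
    snoc {suc n} c a zero    = c zero
    snoc {suc n} c a (suc i) = snoc (λ j → c (suc j)) a i

    snoc-inject₁ : ∀ {n} (c : Vector Carrier n) a i → snoc c a (inject₁ i) ≡ c i
    snoc-inject₁ c a zero    = ≡.refl
    snoc-inject₁ c a (suc i) = snoc-inject₁ (λ j → c (suc j)) a i

    snoc-fromℕ : ∀ {n} (c : Vector Carrier n) a → snoc c a (fromℕ n) ≡ a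
    snoc-fromℕ {zero}  c a = ≡.refl
    snoc-fromℕ {suc n} c a = snoc-fromℕ (λ j → c (suc j)) a

    snoc-∈ : ∀ {n} {c : Vector Carrier n} {a} → (∀ i → F (c i)) → F a → ∀ i → F (snoc c a i)
    snoc-∈ {n = zero}  c∈ a∈ _       = a∈
    snoc-∈ {n = suc n} c∈ a∈ zero    = c∈ zero
    snoc-∈ {F = F} {n = suc n} c∈ a∈ (suc i) = snoc-∈ {F = F} (λ j → c∈ (suc j)) a∈ i

  sum-cong : {s t : Vector Carrier k} → (∀ i → s i ≈ t i) → sum s ≈ sum t
  sum-cong {zero}  e = refl
  sum-cong {suc k} e = +-cong (e zero) (sum-cong λ i → e (suc i))

  sum-leading : ∀ {k} (c : Vector Carrier (suc k)) x →
    sum (λ i → c i * x ^ toℕ i) ≈ c (fromℕ k) * x ^ k + sum (λ i → c (inject₁ i) * x ^ toℕ i)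
  sum-leading {k} c x = begin
    sum (λ i → c i * x ^ toℕ i)  ≈⟨ sum-init-last (λ i → c i * x ^ toℕ i) ⟩
    sum (λ i → c (inject₁ i) * x ^ toℕ (inject₁ i)) + c (fromℕ k) * x ^ toℕ (fromℕ k)
      ≈⟨ +-cong (sum-cong λ i → *-congˡ {c (inject₁ i)} (^-≡ (toℕ-inject₁ i)))
                (*-congˡ (^-≡ (toℕ-fromℕ k))) ⟩
    sum (λ i → c (inject₁ i) * x ^ toℕ i) + c (fromℕ k) * x ^ k  ≈⟨ +-comm _ _ ⟩
    c (fromℕ k) * x ^ k + sum (λ i → c (inject₁ i) * x ^ toℕ i)  ∎
    where
    ^-≡ : ∀ {m n} → m ≡ n → x ^ m ≈ x ^ n
    ^-≡ ≡.refl = refl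

  coeffs⇒polyBelow : (c : Vector Carrier k) → (∀ i → F (c i)) →
                     PolyBelow F k (λ x → sum (λ i → c i * x ^ toℕ i))
  coeffs⇒polyBelow {zero}  c c∈ = zero λ _ → refl
  coeffs⇒polyBelow {suc k} c c∈ =
    suc (c∈ (fromℕ k)) (coeffs⇒polyBelow _ λ i → c∈ (inject₁ i)) (sum-leading c)

  coeffs⇒polyOfDegree : (c : Vector Carrier (suc k)) → (∀ i → F (c i)) → c (fromℕ k) ≉ 0# →
                        PolyOfDegree F k (λ x → sum (λ i → c i * x ^ toℕ i))
  coeffs⇒polyOfDegree {k} c c∈ c≉0 =
    poly (c∈ (fromℕ k)) c≉0 (coeffs⇒polyBelow _ λ i → c∈ (inject₁ i)) (sum-leading c)

  private
    sum-snoc : ∀ {k} (c : Vector Carrier k) a x →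
      a * x ^ k + sum (λ i → c i * x ^ toℕ i) ≈ sum (λ i → snoc c a i * x ^ toℕ i)
    sum-snoc {k} c a x = begin
      a * x ^ k + sum (λ i → c i * x ^ toℕ i)
        ≈⟨ +-cong (*-congʳ (≡⇒≈ (snoc-fromℕ c a)))
                  (sum-cong λ i → *-congʳ {x ^ toℕ i} (≡⇒≈ (snoc-inject₁ c a i))) ⟨
      snoc c a (fromℕ k) * x ^ k + sum (λ i → snoc c a (inject₁ i) * x ^ toℕ i)
        ≈⟨ sum-leading (snoc c a) x ⟨
      sum (λ i → snoc c a i * x ^ toℕ i)  ∎
      where
      ≡⇒≈ : ∀ {y z} → y ≡ z → y ≈ z
      ≡⇒≈ ≡.refl = refl

  polyBelow⇒coeffs : PolyBelow F k f →
    ∃[ c ] (∀ i → F (c i)) × (∀ x → f x ≈ sum {k} (λ i → c i * x ^ toℕ i))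
  polyBelow⇒coeffs (zero e) = (λ ()) , (λ ()) , e
  polyBelow⇒coeffs {F = F} (suc {k = k} {c = a} a∈ p e) = let c , c∈ , e′ = polyBelow⇒coeffs p in
    snoc c a , snoc-∈ {F = F} c∈ a∈ , λ x →
      trans (e x) (trans (+-congˡ (e′ x)) (sum-snoc c a x))

  polyOfDegree⇒coeffs : PolyOfDegree F k f →
    Σ[ c ∈ Vector Carrier (suc k) ] (∀ i → F (c i)) × c (fromℕ k) ≉ 0# ×
    (∀ x → f x ≈ sum (λ i → c i * x ^ toℕ i))
  polyOfDegree⇒coeffs {F = F} {k} (poly {c = a} a∈ a≉0 p e) = let c , c∈ , e′ = polyBelow⇒coeffs p in
    snoc c a , snoc-∈ {F = F} c∈ a∈ ,
    ≡.subst (λ y → y ≉ 0#) (≡.sym (snoc-fromℕ c a)) a≉0 , λ x →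
      trans (e x) (trans (+-congˡ (e′ x)) (sum-snoc c a x))

module NimSpan (N : NimArithmetic) where
  open NimPolynomials N public
  open 𝔽₂-Solver using (solve; _:=_; _:+_; _:*_; con)
  open SetoidReasoning setoid

  private
    variable
      ℓ : Level
      F G : Pred Carrier ℓ
      f : Carrier → Carrier
      x y z b : Carrier
      k : ℕ
      bs bs′ xs : List Carrier

  data Span (F : Pred Carrier ℓ) : List Carrier → Pred Carrier (lsuc 0ℓ ⊔ ℓ) where
    []  : x ≈ 0# → Span F [] x
    _∷_ : ∀ {c r} → F c × x ≈ c * b + r → Span F bs r → Span F (b ∷ bs) x

  span-mono : F ⊆ G → Span F bs ⊆ Span G bs
  span-mono F⊆G ([] e)           = [] e
  span-mono F⊆G ((c∈ , e) ∷ s) = (F⊆G c∈ , e) ∷ span-mono F⊆G s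

  span-resp : Span F bs Respects _≈_
  span-resp e ([] e′)         = [] (trans (sym e) e′)
  span-resp e ((c∈ , e′) ∷ s) = (c∈ , trans (sym e) e′) ∷ s

  module _ {F : Pred Carrier ℓ} (F-isSubring : IsSubring F) where
    open IsSubring F-isSubring

    span-∷ : Span F bs x → Span F (b ∷ bs) x
    span-∷ s = (0∈ , solve 2 (λ x b → x := con false :* b :+ x) refl _ _) ∷ s

    span-0 : ∀ bs → Span F bs 0#
    span-0 []       = [] refl
    span-0 (b ∷ bs) = span-∷ (span-0 bs)

    span-multiple : F z → Span F (b ∷ bs) (z * b)
    span-multiple z∈ = (z∈ , sym (+-identityʳ _)) ∷ span-0 _

    span-head : Span F (b ∷ bs) b
    span-head = span-resp (*-identityˡ _) (span-multiple 1∈)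

    span-+ : Span F bs x → Span F bs y → Span F bs (x + y)
    span-+ ([] e) ([] e′) = [] (trans (+-cong e e′) (+-identityˡ 0#))
    span-+ {bs = b ∷ _} ((c∈ , e) ∷ s) ((c′∈ , e′) ∷ s′) =
      (+-closed c∈ c′∈ , trans (+-cong e e′)
        (solve 5 (λ c b r c′ r′ → (c :* b :+ r) :+ (c′ :* b :+ r′) := (c :+ c′) :* b :+ (r :+ r′))
               refl _ b _ _ _)) ∷ span-+ s s′

    span-scale : F z → Span F bs x → Span F bs (z * x)
    span-scale z∈ ([] e) = [] (trans (*-congˡ e) (*-zeroʳ _))
    span-scale {bs = b ∷ _} z∈ ((c∈ , e) ∷ s) =
      (*-closed z∈ c∈ , trans (*-congˡ e)
        (solve 4 (λ z c b r → z :* (c :* b :+ r) := z :* c :* b :+ z :* r) refl _ _ b _)) ∷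
      span-scale z∈ s

    span-++ : Span F bs x → Span F bs′ y → Span F (bs ++ bs′) (x + y)
    span-++ ([] e) s′ = span-resp (trans (sym (+-identityˡ _)) (+-congʳ (sym e))) s′
    span-++ ((c∈ , e) ∷ s) s′ = (c∈ , trans (+-congʳ e) (+-assoc _ _ _)) ∷ span-++ s s′

    span-map : ∀ y → Span F bs x → Span F (map (_* y) bs) (x * y)
    span-map y ([] e) = [] (trans (*-congʳ e) (*-zeroˡ y))
    span-map {bs = b ∷ _} y ((c∈ , e) ∷ s) = (c∈ , trans (*-congʳ e)
      (solve 4 (λ c b r y → (c :* b :+ r) :* y
                   := c :* (b :* y) :+ r :* y) refl _ b _ y)) ∷ span-map y s

  powers : Carrier → ℕ → List Carrier
  powers y zero    = []
  powers y (suc k) = y ^ k ∷ powers y k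

  polyBelow⇒span : PolyBelow F k f → Span F (powers y k) (f y)
  polyBelow⇒span (zero e)     = [] (e _)
  polyBelow⇒span (suc c∈ p e) = (c∈ , e _) ∷ polyBelow⇒span p

  span⇒polyBelow : ∀ k → Span F (powers y k) x → ∃[ f ] PolyBelow F k f × x ≈ f y
  span⇒polyBelow zero    ([] e) = (λ _ → 0#) , zero (λ _ → refl) , e
  span⇒polyBelow (suc k) (_∷_ {c = c} (c∈ , e) s) =
    let f , p , e′ = span⇒polyBelow k s
    in (λ x → c * x ^ k + f x) , suc c∈ p (λ _ → refl) , trans e (+-congˡ e′)

  -- y is a root of a monic polynomial of degree k over F.
  IntegralOfDegree : Pred Carrier ℓ → ℕ → Pred Carrier (lsuc 0ℓ ⊔ ℓ)
  IntegralOfDegree F k y = Span F (powers y k) (y ^ k)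

  integral⇒root : IsSubring F → IntegralOfDegree F k y → ∃[ f ] PolyOfDegree F k f × f y ≈ 0#
  integral⇒root {k = k} {y} R s = let f , p , e = span⇒polyBelow k s in
    (λ x → 1# * x ^ k + f x) ,
    poly (IsSubring.1∈ R) (<⇒≉ 0<1) p (λ _ → refl) ,
    trans (+-cong (*-identityˡ _) (sym e)) (x+x≈0 _)

  root⇒integral : IsSubfield F → PolyOfDegree F k f → f y ≈ 0# → IntegralOfDegree F k y
  root⇒integral {k = k} {f} {y} K (poly {g = g} {c} c∈ c≉0 p e) fy≈0 =
    let d , d∈ , cd≈1 = inverse c∈ c≉0
    in span-resp (begin
         d * g y                        ≈⟨ +-identityˡ _ ⟨
         0# + d * g y
           ≈⟨ +-congʳ (trans (*-congˡ (trans (sym (e y)) fy≈0)) (*-zeroʳ d)) ⟨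
         d * (c * y ^ k + g y) + d * g y
           ≈⟨ solve 4 (λ c d Y g → d :* (c :* Y :+ g) :+ d :* g
                          := c :* d :* Y) refl c d (y ^ k) (g y) ⟩
         c * d * y ^ k                  ≈⟨ *-congʳ cd≈1 ⟩
         1# * y ^ k                     ≈⟨ *-identityˡ _ ⟩
         y ^ k                          ∎)
       (span-scale isSubring d∈ (polyBelow⇒span p))
    where open IsSubfield K

  -- Some entry of the list is a combination of the later ones; over a field
  -- this is linear dependence.
  Dependent : Pred Carrier ℓ → List Carrier → Set (lsuc 0ℓ ⊔ ℓ)
  Dependent {ℓ} F []       = Lift (lsuc 0ℓ ⊔ ℓ) ⊥
  Dependent     F (x ∷ xs) = Span F xs x ⊎ Dependent F xs

  dependentPowers⇒integral : ∀ n → Dependent F (powers y n) → ∃[ k ] IntegralOfDegree F k y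
  dependentPowers⇒integral (suc n) (inj₁ s) = n , s
  dependentPowers⇒integral (suc n) (inj₂ d) = dependentPowers⇒integral n d

  module _ {F : Pred Carrier ℓ} (F-isSubfield : IsSubfield F) where
    open IsSubfield F-isSubfield

    private
      record Eliminated (b : Carrier) (bs xs : List Carrier) : Set (lsuc 0ℓ ⊔ ℓ) where
        field
          {xs′}     : List Carrier
          inSpan    : All (Span F bs) xs′
          length-xs : length xs ≡ suc (length xs′)
          dependent : Dependent F xs′ → Dependent F xs
          span⊆     : Span F xs′ ⊆ Span F xs
          {pivot c r} : Carrier
          pivot∈    : Span F xs pivot
          c∈        : F c
          c≉0       : c ≉ 0#
          r∈        : Span F bs r
          pivot≈    : pivot ≈ c * b + r

      eliminate : All (Span F (b ∷ bs)) xs → All (Span F bs) xs ⊎ Eliminated b bs xs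
      eliminate [] = inj₁ []
      eliminate {b = b} {xs = x ∷ xs} (_∷_ (_∷_ {c = c} {r} (c∈ , e) s) ss) with eliminate ss
      ... | inj₁ ss′ with c ≟ 0#
      ...   | yes c≈0 = inj₁ (span-resp (begin
                r            ≈⟨ solve 2 (λ r b → r := con false :* b :+ r) refl r b ⟩
                0# * b + r   ≈⟨ +-congʳ (*-congʳ c≈0) ⟨
                c * b + r    ≈⟨ e ⟨
                x            ∎) s ∷ ss′)
      ...   | no c≉0 = inj₂ record
                { inSpan = ss′ ; length-xs = ≡.refl ; dependent = inj₂ ; span⊆ = span-∷ isSubring
                ; pivot∈ = span-head isSubring ; c∈ = c∈ ; c≉0 = c≉0 ; r∈ = s ; pivot≈ = e }
      eliminate {b = b} {xs = x ∷ xs} (_∷_ (_∷_ {c = c} {r} (c∈ , e) s) ss) | inj₂ E =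
        let d , d∈ , cd≈1 = inverse E.c∈ E.c≉0
            m  = c * d
            m∈ = *-closed c∈ d∈
            x′≈ : m * E.r + r ≈ x + m * E.pivot
            x′≈ = begin
              m * E.r + r
                ≈⟨ solve 4 (λ c b u r → u :+ r
                               := (c :* b :+ r) :+ (c :* con true :* b :+ u)) refl c b (m * E.r) r ⟩
              (c * b + r) + (c * 1# * b + m * E.r)
                ≈⟨ +-cong e (+-congʳ (*-congʳ (*-congˡ cd≈1))) ⟨
              x + (c * (E.c * d) * b + m * E.r)
                ≈⟨ +-congˡ (solve 5 (λ c d C b R → c :* (C :* d) :* b :+ c :* d :* R
                                      := c :* d :* (C :* b :+ R))
                                  refl c d E.c b E.r) ⟩
              x + m * (E.c * b + E.r)  ≈⟨ +-congˡ (*-congˡ E.pivot≈) ⟨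
              x + m * E.pivot          ∎
        in inj₂ record
          { xs′       = m * E.r + r ∷ E.xs′
          ; inSpan    = span-+ isSubring (span-scale isSubring m∈ E.r∈) s ∷ E.inSpan
          ; length-xs = ≡.cong suc E.length-xs
          ; dependent =
              [ (λ s′ → inj₁ (span-resp (begin
                  (m * E.r + r) + m * E.pivot    ≈⟨ +-congʳ x′≈ ⟩
                  (x + m * E.pivot) + m * E.pivot
                    ≈⟨ solve 2 (λ x p → (x :+ p) :+ p := x) refl x (m * E.pivot) ⟩
                  x                              ∎)
                  (span-+ isSubring (E.span⊆ s′) (span-scale isSubring m∈ E.pivot∈))))
              , (λ d → inj₂ (E.dependent d)) ]′
          ; span⊆     = λ { (_∷_ {c = c′} (c′∈ , e′) s′) → span-resp
              (sym (trans e′ (+-congʳ (*-congˡ x′≈))))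
              (span-+ isSubring (span-scale isSubring c′∈
                (span-+ isSubring (span-head isSubring)
                  (span-∷ isSubring (span-scale isSubring m∈ E.pivot∈))))
                (span-∷ isSubring (E.span⊆ s′))) }
          ; pivot∈    = span-∷ isSubring E.pivot∈
          ; c∈        = E.c∈
          ; c≉0       = E.c≉0
          ; r∈        = E.r∈
          ; pivot≈    = E.pivot≈
          }
        where module E = Eliminated E

    overlong⇒dependent : ∀ bs → All (Span F bs) xs → length bs ℕ.< length xs → Dependent F xs
    overlong⇒dependent []       ([] e ∷ _) _  = inj₁ (span-resp (sym e) (span-0 isSubring _))
    overlong⇒dependent (b ∷ bs) ss         lt with eliminate ss
    ... | inj₁ ss′ = overlong⇒dependent bs ss′ (ℕ.<-trans (ℕ.n<1+n _) lt)
    ... | inj₂ E   = Eliminated.dependent E (overlong⇒dependent bs (Eliminated.inSpan E)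
                       (ℕ.s<s⁻¹ (≡.subst (suc (length bs) ℕ.<_) (Eliminated.length-xs E) lt)))

module NimAlgebraic (N : NimArithmetic) where
  open NimSpan N public
  open 𝔽₂-Solver using (solve; _:=_; _:+_; _:*_; con)
  open SetoidReasoning setoid

  private
    variable
      ℓ : Level
      F : Pred Carrier ℓ
      f g : Carrier → Carrier
      w x y z : Carrier
      k : ℕ
      bs : List Carrier

  module Algebraic {U : Pred Carrier 0ℓ} (U-isSubfield : IsSubfield U) where
    private
      module U = IsSubfield U-isSubfield

    record IsFiniteExtension (A : Pred Carrier (lsuc 0ℓ)) : Set (lsuc 0ℓ) where
      field
        isSubring : IsSubring A
        U⊆        : U ⊆ A
        basis     : List Carrier
        spanned   : A ⊆ Span U basis

      open IsSubring isSubring public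

    IsIntegral : Pred Carrier (lsuc 0ℓ)
    IsIntegral y = ∃[ k ] IntegralOfDegree U k y

    module _ {A : Pred Carrier (lsuc 0ℓ)} (A-isFiniteExtension : IsFiniteExtension A) where
      open IsFiniteExtension A-isFiniteExtension

      finiteExtension⇒integral : A ⊆ IsIntegral
      finiteExtension⇒integral {y} y∈ = dependentPowers⇒integral (suc (length basis))
        (overlong⇒dependent U-isSubfield basis (powers-spanned (suc (length basis)))
          (ℕ.≤-reflexive (≡.sym (length-powers (suc (length basis))))))
        where
        powers-spanned : ∀ n → All (Span U basis) (powers y n)
        powers-spanned zero    = []
        powers-spanned (suc n) = spanned (^-closed y∈ n) ∷ powers-spanned n

        length-powers : ∀ n → length (powers y n) ≡ n
        length-powers zero    = ≡.refl
        length-powers (suc n) = ≡.cong suc (length-powers n)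

      module _ {y : Carrier} {k : ℕ} (y-integral : IntegralOfDegree A (suc k) y) where
        private
          A[y] : Pred Carrier (lsuc 0ℓ)
          A[y] = Span A (powers y (suc k))

          const∈ : ∀ k → A x → Span A (powers y (suc k)) x
          const∈ zero    x∈ = span-resp (*-identityʳ _) (span-multiple isSubring x∈)
          const∈ (suc k) x∈ = span-∷ isSubring (const∈ k x∈)

          y*-shift : ∀ k → Span A (powers y k) x → Span A (powers y (suc k)) (y * x)
          y*-shift zero    ([] e) =
            span-resp (sym (trans (*-congˡ e) (*-zeroʳ y))) (span-0 isSubring _)
          y*-shift (suc k) (_∷_ {c = c} {r} (c∈ , e) s) =
            (c∈ , trans (*-congˡ e)
              (solve 4 (λ y c Y r → y :* (c :* Y :+ r)
                           := c :* (y :* Y) :+ y :* r) refl y c (y ^ k) r)) ∷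
            y*-shift k s

          y*-closed : A[y] x → A[y] (y * x)
          y*-closed {x} (_∷_ {c = c} {r} (c∈ , e) s) = span-resp (begin
            c * y ^ suc k + y * r
              ≈⟨ solve 4 (λ y c Y r → c :* (y :* Y) :+ y :* r
                             := y :* (c :* Y :+ r)) refl y c (y ^ k) r ⟩
            y * (c * y ^ k + r)    ≈⟨ *-congˡ e ⟨
            y * x                  ∎)
            (span-+ isSubring (span-scale isSubring c∈ y-integral) (y*-shift k s))

          y^*-closed : ∀ j → A[y] x → A[y] (y ^ j * x)
          y^*-closed zero    s = span-resp (sym (*-identityˡ _)) s
          y^*-closed (suc j) s = span-resp (sym (*-assoc y _ _)) (y*-closed (y^*-closed j s))

          A[y]-*-closed : ∀ j → Span A (powers y j) x → A[y] z → A[y] (x * z)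
          A[y]-*-closed zero ([] e) z∈ =
            span-resp (sym (trans (*-congʳ e) (*-zeroˡ _))) (span-0 isSubring _)
          A[y]-*-closed {x} {z} (suc j) (_∷_ {c = c} {r} (c∈ , e) s) z∈ = span-resp (begin
            c * (y ^ j * z) + r * z
              ≈⟨ solve 4 (λ c Y z r → c :* (Y :* z) :+ r :* z
                             := (c :* Y :+ r) :* z) refl c (y ^ j) z r ⟩
            (c * y ^ j + r) * z      ≈⟨ *-congʳ e ⟨
            x * z                    ∎)
            (span-+ isSubring (span-scale isSubring c∈ (y^*-closed j z∈)) (A[y]-*-closed j s z∈))

          basis[y] : ℕ → List Carrier
          basis[y] zero    = []
          basis[y] (suc j) = map (_* y ^ j) basis ++ basis[y] j

          A[y]-spanned : ∀ j → Span A (powers y j) ⊆ Span U (basis[y] j)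
          A[y]-spanned zero    ([] e)         = [] e
          A[y]-spanned (suc j) ((c∈ , e) ∷ s) = span-resp (sym e)
            (span-++ U.isSubring (span-map U.isSubring (y ^ j) (spanned c∈)) (A[y]-spanned j s))

        adjoin : Σ[ B ∈ Pred Carrier (lsuc 0ℓ) ] IsFiniteExtension B × A ⊆ B × B y
        adjoin = A[y] , record
          { isSubring = record
            { resp     = span-resp
            ; 0∈       = span-0 isSubring _
            ; 1∈       = const∈ k 1∈
            ; +-closed = span-+ isSubring
            ; *-closed = A[y]-*-closed (suc k)
            }
          ; U⊆      = λ u∈ → const∈ k (U⊆ u∈)
          ; basis   = basis[y] (suc k)
          ; spanned = A[y]-spanned (suc k)
          } , const∈ k , span-resp (*-identityʳ y) (y*-closed (const∈ k 1∈))

      adjoinIntegral : IntegralOfDegree A k y →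
                       Σ[ B ∈ Pred Carrier (lsuc 0ℓ) ] IsFiniteExtension B × A ⊆ B × B y
      adjoinIntegral {zero}  ([] 1≈0) = ⊥-elim (<⇒≉ 0<1 1≈0)
      adjoinIntegral {suc k} s        = adjoin s

    trivialExtension : IsFiniteExtension (λ x → Lift (lsuc 0ℓ) (U x))
    trivialExtension = record
      { isSubring = record
        { resp     = λ e (lift x∈) → lift (U.resp e x∈)
        ; 0∈       = lift U.0∈
        ; 1∈       = lift U.1∈
        ; +-closed = λ (lift x∈) (lift y∈) → lift (U.+-closed x∈ y∈)
        ; *-closed = λ (lift x∈) (lift y∈) → lift (U.*-closed x∈ y∈)
        }
      ; U⊆      = lift
      ; basis   = 1# ∷ []
      ; spanned = λ (lift x∈) → span-resp (*-identityʳ _) (span-multiple U.isSubring x∈)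
      }

    collectCoefficients : ∀ {A} → IsFiniteExtension A → Span IsIntegral bs x →
      Σ[ B ∈ Pred Carrier (lsuc 0ℓ) ] IsFiniteExtension B × A ⊆ B × Span B bs x
    collectCoefficients {A = A} A-ext ([] e) = A , A-ext , (λ a∈ → a∈) , [] e
    collectCoefficients A-ext (((_ , c-integral) , e) ∷ s) =
      let B , B-ext , A⊆B , s′ = collectCoefficients A-ext s
          C , C-ext , B⊆C , c∈ = adjoinIntegral B-ext
            (span-mono (IsFiniteExtension.U⊆ B-ext) c-integral)
      in C , C-ext , (λ a∈ → B⊆C (A⊆B a∈)) , (c∈ , e) ∷ span-mono B⊆C s′

    integral-trans : IntegralOfDegree IsIntegral k y → IsIntegral y
    integral-trans s =
      let A , A-ext , _ , s′ = collectCoefficients trivialExtension s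
          B , B-ext , _ , y∈ = adjoinIntegral A-ext s′
      in finiteExtension⇒integral B-ext y∈

    integral⇒finiteExtension : IsIntegral x →
      Σ[ A ∈ Pred Carrier (lsuc 0ℓ) ] IsFiniteExtension A × A x
    integral⇒finiteExtension (_ , s) =
      let A , A-ext , _ , x∈ = adjoinIntegral trivialExtension (span-mono lift s) in A , A-ext , x∈

    integral⇒finiteExtension₂ : IsIntegral x → IsIntegral y →
      Σ[ A ∈ Pred Carrier (lsuc 0ℓ) ] IsFiniteExtension A × A x × A y
    integral⇒finiteExtension₂ x-int (_ , s) =
      let A , A-ext , x∈ = integral⇒finiteExtension x-int
          B , B-ext , A⊆B , y∈ = adjoinIntegral A-ext (span-mono (IsFiniteExtension.U⊆ A-ext) s)
      in B , B-ext , A⊆B x∈ , y∈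

    U⇒integral : U ⊆ IsIntegral
    U⇒integral x∈ = finiteExtension⇒integral trivialExtension (lift x∈)

    integral-isSubring : IsSubring IsIntegral
    integral-isSubring = record
      { resp     = λ e x-int → let A , ext , x∈ = integral⇒finiteExtension x-int in
                   finiteExtension⇒integral ext (IsFiniteExtension.resp ext e x∈)
      ; 0∈       = U⇒integral U.0∈
      ; 1∈       = U⇒integral U.1∈
      ; +-closed = λ x-int y-int → let A , ext , x∈ , y∈ = integral⇒finiteExtension₂ x-int y-int in
                   finiteExtension⇒integral ext (IsFiniteExtension.+-closed ext x∈ y∈)
      ; *-closed = λ x-int y-int → let A , ext , x∈ , y∈ = integral⇒finiteExtension₂ x-int y-int in
                   finiteExtension⇒integral ext (IsFiniteExtension.*-closed ext x∈ y∈)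
      }

    -- If f(x) = f(0) + x g(x) = 0, then either f(0) ≠ 0 and x⁻¹ = g(x) / f(0),
    -- or x is also a root of g.
    root-inverse∈ : IsSubring F → U ⊆ F → F x → x * y ≈ 1# →
                    PolyOfDegree U k f → f x ≈ 0# → F y
    root-inverse∈ {k = zero} F-ring U⊆F x∈ xy≈1 p fx≈0 = ⊥-elim (polyOfDegree-0-noRoot p fx≈0)
    root-inverse∈ {x = x} {y} {suc k} {f} F-ring U⊆F x∈ xy≈1 p fx≈0
      with factor U.isSubring U.0∈ p
    ... | g , q , e with f 0# ≟ 0#
    ...   | yes f0≈0 = root-inverse∈ F-ring U⊆F x∈ xy≈1 q (begin
            g x                       ≈⟨ *-identityˡ _ ⟨
            1# * g x                  ≈⟨ *-congʳ xy≈1 ⟨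
            x * y * g x
              ≈⟨ solve 3 (λ x y g → x :* y :* g
                             := y :* (con false :+ (x :+ con false) :* g)) refl x y (g x) ⟩
            y * (0# + (x + 0#) * g x) ≈⟨ *-congˡ (+-congʳ f0≈0) ⟨
            y * (f 0# + (x + 0#) * g x) ≈⟨ *-congˡ (e x) ⟨
            y * f x                   ≈⟨ trans (*-congˡ fx≈0) (*-zeroʳ y) ⟩
            0#                        ∎)
    ...   | no f0≉0 =
            let c , c∈ , f0*c≈1 = U.inverse (polyOfDegree-closed U.isSubring p U.0∈) f0≉0
            in resp (begin
                 c * g x                    ≈⟨ *-identityʳ _ ⟨
                 c * g x * 1#               ≈⟨ *-congˡ xy≈1 ⟨
                 c * g x * (x * y)
                   ≈⟨ solve 4 (λ c g x y → c :* g :* (x :* y)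
                                  := c :* y :* ((x :+ con false) :* g)) refl c (g x) x y ⟩
                 c * y * ((x + 0#) * g x)
                   ≈⟨ *-congˡ (x+y≈0⇒x≈y (trans (sym (e x)) fx≈0)) ⟨
                 c * y * f 0#
                   ≈⟨ solve 3 (λ c y u → c :* y :* u := u :* c :* y) refl c y (f 0#) ⟩
                 f 0# * c * y               ≈⟨ *-congʳ f0*c≈1 ⟩
                 1# * y                     ≈⟨ *-identityˡ y ⟩
                 y                          ∎)
               (*-closed (U⊆F c∈) (polyOfDegree-closed F-ring (polyOfDegree-mono U⊆F q) x∈))
      where open IsSubring F-ring

    integral-inverse : IsIntegral x → x * y ≈ 1# → IsIntegral y
    integral-inverse x-int@(_ , s) xy≈1 =
      let f , p , fx≈0 = integral⇒root U.isSubring s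
          A , ext , x∈ = integral⇒finiteExtension x-int
      in finiteExtension⇒integral ext
           (root-inverse∈ (IsFiniteExtension.isSubring ext) (IsFiniteExtension.U⊆ ext) x∈ xy≈1 p fx≈0)

  inverse-unique : x * y ≈ 1# → x * z ≈ 1# → y ≈ z
  inverse-unique {x} {y} {z} xy≈1 xz≈1 = begin
    y            ≈⟨ *-identityʳ y ⟨
    y * 1#       ≈⟨ *-congˡ xz≈1 ⟨
    y * (x * z)  ≈⟨ solve 3 (λ x y z → y :* (x :* z) := x :* y :* z) refl x y z ⟩
    x * y * z    ≈⟨ *-congʳ xy≈1 ⟩
    1# * z       ≈⟨ *-identityˡ z ⟩
    z            ∎

  least : ExcludedMiddle (lsuc 0ℓ ⊔ ℓ) → (P : Pred Carrier ℓ) → P x →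
          ∃[ v ] P v × (∀ {w} → w < v → ¬ P w)
  least em P = go (<-wellFounded _)
    where
    go : ∀ {x} → Acc _<_ x → P x → ∃[ v ] P v × (∀ {w} → w < v → ¬ P w)
    go {x} (acc rx) px with em {∃[ y ] y < x × P y}
    ... | yes (y , y<x , py) = go (rx y<x) py
    ... | no ∄y              = x , px , λ {w} w<x pw → ∄y (w , w<x , pw)

  ↓ : Carrier → Pred Carrier 0ℓ
  ↓ v x = x < v

  module _ {K : Pred Carrier ℓ} (K-isSubring : IsSubring K)
           (K-inverse : ∀ {x y} → K x → x * y ≈ 1# → K y)
           {v : Carrier} (v∉K : ¬ K v) (↓v⊆K : ↓ v ⊆ K) where
    private
      module K = IsSubring K-isSubring

      K⇒≉v : K x → x ≉ v
      K⇒≉v x∈ x≈v = v∉K (K.resp x≈v x∈)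

      K⇒<v : K x → (v < x → x < v) → x < v
      K⇒<v {x} x∈ f with compare x v
      ... | tri< x<v _ _ = x<v
      ... | tri≈ _ x≈v _ = ⊥-elim (K⇒≉v x∈ x≈v)
      ... | tri> _ _ v<x = f v<x

      0<v : 0# < v
      0<v = K⇒<v K.0∈ (λ v<0 → ⊥-elim (0-minimal v<0))

      1<v : 1# < v
      1<v = K⇒<v K.1∈ (λ v<1 → ⊥-elim (K⇒≉v K.0∈ (sym (<1⇒≈0 v<1))))

      ↓v-+′ : Acc _<_ x → Acc _<_ y → x < v → y < v → x + y < v
      ↓v-+′ (acc rx) (acc ry) x<v y<v = K⇒<v (K.+-closed (↓v⊆K x<v) (↓v⊆K y<v)) λ v<x+y → ⊥-elim
        ([ (λ (x′ , x′<x , e) → irrefl (sym e) (↓v-+′ (rx x′<x) (acc ry) (<-trans x′<x x<v) y<v))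
         , (λ (y′ , y′<y , e) → irrefl (sym e) (↓v-+′ (acc rx) (ry y′<y) x<v (<-trans y′<y y<v)))
         ]′ (+-option v<x+y))

      ↓v-+ : x < v → y < v → x + y < v
      ↓v-+ = ↓v-+′ (<-wellFounded _) (<-wellFounded _)

      ↓v-*′ : Acc _<_ x → Acc _<_ y → x < v → y < v → x * y < v
      ↓v-*′ (acc rx) (acc ry) x<v y<v = K⇒<v (K.*-closed (↓v⊆K x<v) (↓v⊆K y<v)) λ v<x*y → ⊥-elim
        (let x′ , y′ , x′<x , y′<y , e = *-option v<x*y
             x′<v = <-trans x′<x x<v
             y′<v = <-trans y′<y y<v
         in irrefl (sym e) (↓v-+ (↓v-+ (↓v-*′ (rx x′<x) (acc ry) x′<v y<v)
                                       (↓v-*′ (acc rx) (ry y′<y) x<v y′<v))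
                                 (↓v-*′ (rx x′<x) (ry y′<y) x′<v y′<v)))

      ↓v-* : x < v → y < v → x * y < v
      ↓v-* = ↓v-*′ (<-wellFounded _) (<-wellFounded _)

      HasInverse : Pred Carrier (lsuc 0ℓ)
      HasInverse x = ∃[ y ] y < v × x * y ≈ 1#

      -- If x is the least nonzero element without inverse, then v is its inverse:
      -- solving 1 = x′ v + x v′ + x′ v′ for v would put v below v.
      ↓v-inverse′ : ExcludedMiddle (lsuc 0ℓ) → Acc _<_ x → x < v → x ≉ 0# → HasInverse x
      ↓v-inverse′ {x} em (acc rx) x<v x≉0 with em {HasInverse x}
      ... | yes inv = inv
      ... | no ¬inv = ⊥-elim (v∉K (K-inverse (↓v⊆K x<v) (≮∧≯⇒≈ x*v≮1 1≮x*v)))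
        where
        x*v≮1 : ¬ x * v < 1#
        x*v≮1 lt = *-excluded (≉0⇒0< x≉0) 0<v (trans (<1⇒≈0 lt)
          (solve 2 (λ x v → con false
                       := con false :* v :+ x :* con false :+ con false :* con false) refl x v))

        1≮x*v : ¬ 1# < x * v
        1≮x*v lt with *-option lt
        ... | x′ , w , x′<x , w<v , e with x′ ≟ 0#
        ...   | yes x′≈0 = ¬inv (w , w<v , (begin
                x * w
                  ≈⟨ solve 3 (λ x w v → x :* w
                                 := con false :* v :+ x :* w :+ con false :* w) refl x w v ⟩
                0# * v + x * w + 0# * w
                  ≈⟨ +-cong (+-congʳ (*-congʳ x′≈0)) (*-congʳ x′≈0) ⟨
                x′ * v + x * w + x′ * w              ≈⟨ e ⟨
                1#                                   ∎))
        ...   | no x′≉0 =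
                let c , c<v , x′c≈1 = ↓v-inverse′ em (rx x′<x) (<-trans x′<x x<v) x′≉0
                in irrefl (begin
                     c * (1# + (x + x′) * w)
                       ≈⟨ *-congˡ (+-congʳ e) ⟩
                     c * (x′ * v + x * w + x′ * w + (x + x′) * w)
                       ≈⟨ solve 5 (λ c x′ v x w → c :* (x′ :* v :+ x :* w :+ x′ :* w :+ (x :+ x′) :* w)
                                                := x′ :* c :* v) refl c x′ v x w ⟩
                     x′ * c * v    ≈⟨ *-congʳ x′c≈1 ⟩
                     1# * v        ≈⟨ *-identityˡ v ⟩
                     v             ∎)
                   (↓v-* c<v (↓v-+ 1<v (↓v-* (↓v-+ x<v (<-trans x′<x x<v)) w<v)))

    ↓-isSubfield : ExcludedMiddle (lsuc 0ℓ) → IsSubfield (↓ v)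
    ↓-isSubfield em = record
      { isSubring = record
        { resp     = <-respˡ-≈
        ; 0∈       = 0<v
        ; 1∈       = 1<v
        ; +-closed = ↓v-+
        ; *-closed = ↓v-*
        }
      ; inverse   = ↓v-inverse′ em (<-wellFounded _)
      }

  data Split (F : Pred Carrier ℓ) : ℕ → (Carrier → Carrier) → Set (lsuc 0ℓ ⊔ ℓ) where
    one    : (∀ x → f x ≈ 1#) → Split F 0 f
    linear : F y → Split F k g → (∀ x → f x ≈ (x + y) * g x) → Split F (suc k) f

  split⇒monic : IsSubring F → Split F k f →
                ∃[ g ] PolyBelow F k g × (∀ x → f x ≈ x ^ k + g x)
  split⇒monic R (one e) = (λ _ → 0#) , zero (λ _ → refl) , λ x → trans (e x) (sym (+-identityʳ 1#))
  split⇒monic R (linear {y = y} {k} {g} y∈ s e) = let h , p , e′ = split⇒monic R s in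
    (λ x → x * h x + (y * x ^ k + y * h x)) ,
    polyBelow-+ R (polyBelow-shift R p) (suc y∈ (polyBelow-scale R y∈ p) λ _ → refl) ,
    λ x → trans (e x) (trans (*-congˡ (e′ x))
      (solve 4 (λ x y X h → (x :+ y) :* (X :+ h) := x :* X :+ (x :* h :+ (y :* X :+ y :* h)))
             refl x y (x ^ k) (h x)))

  module _ {v : Carrier} (v-isSubfield : IsSubfield (↓ v)) where
    open IsSubfield v-isSubfield

    -- The n-fold form of the recursion for the product: the options of v ^ k are
    -- the v ^ k + Π (v + xᵢ) with xᵢ < v.
    <^⇒split : ∀ k → w < v ^ k → ∃[ f ] Split (↓ v) k f × v ^ k + w ≈ f v
    <^⇒split zero w<1 = (λ _ → 1#) , one (λ _ → refl) , trans (+-congˡ (<1⇒≈0 w<1)) (+-identityʳ 1#)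
    <^⇒split {w} (suc k) w<v^k =
      let x , w′ , x<v , w′<v^k , e = *-option w<v^k
          f , s , e′ = <^⇒split k w′<v^k
      in (λ z → (z + x) * f z) , linear x<v s (λ _ → refl) , (begin
           v * v ^ k + w                                       ≈⟨ +-congˡ e ⟩
           v * v ^ k + (x * v ^ k + v * w′ + x * w′)
             ≈⟨ solve 4 (λ v V x w → v :* V :+ (x :* V :+ v :* w :+ x :* w) := (v :+ x) :* (V :+ w))
                      refl v (v ^ k) x w′ ⟩
           (v + x) * (v ^ k + w′)                              ≈⟨ *-congˡ e′ ⟩
           (v + x) * f v                                       ∎)

    <^⇒span : ∀ k → w < v ^ k → Span (↓ v) (powers v k) w
    <^⇒span {w} k w<v^k =
      let f , s , e = <^⇒split k w<v^k
          g , p , e′ = split⇒monic isSubring s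
      in span-resp (sym (+-cancelˡ (trans e (e′ v)))) (polyBelow⇒span p)

    module _ (n : ℕ) (v-notIntegral : ∀ {k} → k ℕ.≤ n → ¬ IntegralOfDegree (↓ v) k v) where

      span⇒<^ : ∀ k → k ℕ.≤ n → Span (↓ v) (powers v k) w → w < v ^ k
      span-downwards : ∀ k → k ℕ.≤ n → z < w → Span (↓ v) (powers v k) w → Span (↓ v) (powers v k) z

      span⇒<^ {w} k k≤n s with compare w (v ^ k)
      ... | tri< w<v^k _ _ = w<v^k
      ... | tri≈ _ w≈v^k _ = ⊥-elim (v-notIntegral k≤n (span-resp w≈v^k s))
      ... | tri> _ _ v^k<w = ⊥-elim (v-notIntegral k≤n (span-downwards k k≤n v^k<w s))

      span-downwards zero    _   z<w ([] w≈0) = ⊥-elim (0-minimal (<-respʳ-≈ w≈0 z<w))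
      span-downwards (suc k) k<n z<w (_∷_ {c = x} {r} (x<v , e) s) =
        [ (λ (δ , δ<xv^k , e′) →
            let x′ , w′ , x′<x , w′<v^k , e″ = *-option δ<xv^k
                w′∈ = span-∷ isSubring (<^⇒span k w′<v^k)
                x′<v = <-trans x′<x x<v
            in span-resp (sym (trans e′ (+-congʳ e″)))
                 (span-+ isSubring
                   (span-+ isSubring
                     (span-+ isSubring (span-multiple isSubring x′<v) (span-scale isSubring x<v w′∈))
                     (span-scale isSubring x′<v w′∈))
                   (span-∷ isSubring s)))
        , (λ (r′ , r′<r , e′) → (x<v , e′) ∷ span-downwards k (ℕ.<⇒≤ k<n) r′<r s)
        ]′ (+-option (<-respʳ-≈ e z<w))

      polyBelow-vanishes : k ℕ.≤ n → PolyBelow (↓ v) k f → f v ≈ 0# → ∀ x → f x ≈ 0#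
      polyBelow-vanishes k≤n (zero e) _ = e
      polyBelow-vanishes {f = f} k<n (suc {k = k} {g = g} {c = c} c∈ p e) fv≈0 x with c ≟ 0#
      ... | no c≉0  = ⊥-elim
        (v-notIntegral (ℕ.<⇒≤ k<n) (root⇒integral v-isSubfield (poly c∈ c≉0 p e) fv≈0))
      ... | yes c≈0 = trans (f≈g x) (polyBelow-vanishes (ℕ.<⇒≤ k<n) p (trans (sym (f≈g v)) fv≈0) x)
        where
        f≈g : ∀ x → f x ≈ g x
        f≈g x = begin
          f x               ≈⟨ e x ⟩
          c * x ^ k + g x   ≈⟨ +-congʳ (*-congʳ c≈0) ⟩
          0# * x ^ k + g x  ≈⟨ solve 2 (λ X g → con false :* X :+ g := g) refl (x ^ k) (g x) ⟩
          g x               ∎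

      -- Every value of a polynomial of degree < k at v is an option of v ^ k, so
      -- every monic polynomial of degree k agrees at v, hence identically, with
      -- a product of linear factors.
      ↓-isClosed : IsClosed n (↓ v)
      ↓-isClosed {suc k} {f} _ k≤n (poly {g = g} {c = c} c∈ c≉0 p e)
        with inverse c∈ c≉0
      ... | d , d∈ , cd≈1
        with <^⇒split (suc k) (span⇒<^ (suc k) k≤n (span-scale isSubring d∈ (polyBelow⇒span p)))
      ... | s , split@(linear {y = y} {g = s′} y∈ _ s≈) , e′
        with split⇒monic isSubring split
      ... | h , q , e″ = y , y∈ , (begin
        f y                                  ≈⟨ e y ⟩
        c * Y + g y
          ≈⟨ +-congˡ (trans (sym (*-identityˡ _)) (*-congʳ (sym cd≈1))) ⟩
        c * Y + c * d * g y
          ≈⟨ solve 4 (λ c Y d g → c :* Y :+ c :* d :* g := c :* (Y :+ d :* g)) refl c Y d (g y) ⟩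
        c * (Y + d * g y)                    ≈⟨ *-congˡ (+-congˡ (x+y≈0⇒x≈y (difference≈0 y))) ⟩
        c * (Y + h y)                        ≈⟨ *-congˡ (e″ y) ⟨
        c * s y                              ≈⟨ *-congˡ (s≈ y) ⟩
        c * ((y + y) * s′ y)
          ≈⟨ solve 3 (λ c y s → c :* ((y :+ y) :* s) := con false) refl c y (s′ y) ⟩
        0#                                   ∎)
        where
        Y = y ^ suc k
        difference≈0 : ∀ x → d * g x + h x ≈ 0#
        difference≈0 = polyBelow-vanishes k≤n
          (polyBelow-+ isSubring (polyBelow-scale isSubring d∈ p) q)
          (trans (+-congʳ (+-cancelˡ (trans e′ (e″ v)))) (x+x≈0 (h v)))

open import Defs

branch : (α : Ord) → Index (tree α) → Ord
branch α i = ord (elem (tree α) i) (elem-isOrd _ (isOrd α) i)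

nimArithmetic : ExcludedMiddle 0ℓ → NimArithmetic
nimArithmetic em = record
  { Carrier = Ord ; _≈_ = _≈_ ; _<_ = _<_ ; _+_ = _⊕_ ; _*_ = _⊗_ ; 0# = 0ₒ ; 1# = 1ₒ
  ; isStrictTotalOrder = record
    { isStrictPartialOrder = record
      { isEquivalence = record { refl = ≋-refl ; sym = ≋-sym ; trans = ≋-trans }
      ; irrefl        = λ {α} {β} → <-irrefl α β
      ; trans         = λ {α} {β} {γ} → <-trans α β γ
      ; <-resp-≈      = (λ {α} {β} {γ} → ∈-respʳ {tree β} {tree γ}) ,
                        (λ {α} {β} {γ} → ∈-respˡ {tree β} {tree γ} {tree α})
      }
    ; compare = compare
    }
  ; <-wellFounded = λ α → <-acc (tree α) α ≋-refl
  ; 0-minimal     = λ ()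
  ; 0<1           = _ , ≋-refl
  ; <1⇒≈0         = proj₂
  ; +-cong        = ⊕ⱽ-cong _ _ _ _
  ; +-excludedˡ   = λ {α} {α′} {β} lt e → proj₁ (⊕-isMex α β) (inj₁ (α′ , lt , e))
  ; +-excludedʳ   = λ {α} {β} {β′} lt e → proj₁ (⊕-isMex α β) (inj₂ (β′ , lt , e))
  ; +-option      = λ {α} {β} {γ} → proj₂ (⊕-isMex α β) γ
  ; *-cong        = ⊗ⱽ-cong _ _ _ _
  ; *-excluded    = λ {α} {α′} {β} {β′} lt lt′ e → proj₁ (⊗-isMex α β) (α′ , β′ , lt , lt′ , e)
  ; *-option      = λ {α} {β} {γ} → proj₂ (⊗-isMex α β) γ
  }
  where
  <-irrefl : ∀ α β → α ≈ β → ¬ α < β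
  <-irrefl α β α≈β α<β = ∈-irrefl (tree β) (∈-respˡ {tree α} {tree β} {tree β} α≈β α<β)

  <-trans : ∀ α β γ → α < β → β < γ → α < γ
  <-trans α β γ α<β β<γ = transitive (isOrd γ) (tree β) (tree α) β<γ α<β

  <-acc : ∀ t α → tree α ≋ t → Acc _<_ α
  <-acc (set A f) α e = acc λ {β} β<α →
    let a , e′ = ∈-respʳ {tree α} {set A f} {tree β} e β<α in <-acc (f a) β e′

  ≋-ext : ∀ {x y} → (∀ i → elem x i ∈ y) → (∀ j → elem y j ∈ x) → x ≋ y
  ≋-ext {set A f} {set B g} x⊆y y⊆x = x⊆y , λ j → proj₁ (y⊆x j) , ≋-sym (proj₂ (y⊆x j))

  connex : ∀ {α β} → Acc _<_ α → Acc _<_ β → α < β ⊎ α ≈ β ⊎ β < α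
  connex {α} {β} (acc rα) (acc rβ)
    with em {∃[ i ] ¬ branch α i < β} | em {∃[ j ] ¬ branch β j < α}
  ... | yes (i , i≮β) | _ = inj₂ (inj₂
    ([ (λ i<β → ⊥-elim (i≮β i<β))
     , [ (λ i≈β → i , ≋-sym i≈β) , (λ β<i → <-trans β (branch α i) α β<i (elem-∈ (tree α) i)) ]′
     ]′ (connex {branch α i} {β} (rα {branch α i} (elem-∈ (tree α) i)) (acc rβ))))
  ... | no _ | yes (j , j≮α) = inj₁
    ([ (λ α<j → <-trans α (branch β j) β α<j (elem-∈ (tree β) j))
     , [ (λ α≈j → j , α≈j) , (λ j<α → ⊥-elim (j≮α j<α)) ]′
     ]′ (connex {α} {branch β j} (acc rα) (rβ {branch β j} (elem-∈ (tree β) j))))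
  ... | no α⊆β | no β⊆α = inj₂ (inj₁ (≋-ext
    (λ i → decidable-stable em λ i≮β → α⊆β (i , i≮β))
    (λ j → decidable-stable em λ j≮α → β⊆α (j , j≮α))))

  compare : Trichotomous _≈_ _<_
  compare α β with connex {α} {β} (<-acc (tree α) α ≋-refl) (<-acc (tree β) β ≋-refl)
  ... | inj₁ α<β        = tri< α<β (λ e → <-irrefl α β e α<β)
                               (λ β<α → ∈-irrefl (tree α) (<-trans α β α α<β β<α))
  ... | inj₂ (inj₁ α≈β) = tri≈ (<-irrefl α β α≈β) α≈β (<-irrefl β α (≋-sym α≈β))
  ... | inj₂ (inj₂ β<α) = tri> (λ α<β → ∈-irrefl (tree α) (<-trans α β α α<β β<α))
                               (λ e → <-irrefl β α (≋-sym e) β<α) β<α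

module _ (em : ∀ {ℓ} → ExcludedMiddle ℓ) where
  private
    module Nim = NimAlgebraic (nimArithmetic em)

  isSubfield⇒ : ∀ {ℓ} {F : Pred Ord ℓ} → IsSubfield F → Nim.IsSubfield F
  isSubfield⇒ S = record
    { isSubring = record
      { resp     = λ {α} {β} → resp {α} {β}
      ; 0∈       = 0∈
      ; 1∈       = 1∈
      ; +-closed = λ {α} {β} → ⊕-closed {α} {β}
      ; *-closed = λ {α} {β} → ⊗-closed {α} {β}
      }
    ; inverse   = λ {α} → inv-closed {α}
    }
    where open IsSubfield S

  ⇒isSubfield : ∀ {ℓ} {F : Pred Ord ℓ} → Nim.IsSubfield F → IsSubfield F
  ⇒isSubfield S = record
    { resp       = λ {α} {β} → resp {α} {β}
    ; 0∈         = 0∈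
    ; 1∈         = 1∈
    ; ⊕-closed   = λ {α} {β} → +-closed {α} {β}
    ; ⊗-closed   = λ {α} {β} → *-closed {α} {β}
    ; neg-closed = λ {α} α∈ → α , α∈ , Nim.x+x≈0 α
    ; inv-closed = λ {α} → inverse {α}
    }
    where open Nim.IsSubfield S

  eval-polyOfDegree : ∀ {ℓ} {F : Pred Ord ℓ} {d} (p : Polynomial F d) →
                      Nim.PolyOfDegree F d (eval p)
  eval-polyOfDegree p = Nim.coeffs⇒polyOfDegree (coeff p) (coeff∈ p) (leading≉0 p)

  polyOfDegree⇒polynomial : ∀ {ℓ} {F : Pred Ord ℓ} {d f} → Nim.PolyOfDegree F d f →
    Σ[ p ∈ Polynomial F d ] (∀ α → f α ≈ eval p α)
  polyOfDegree⇒polynomial q = let c , c∈ , c≉0 , e = Nim.polyOfDegree⇒coeffs q in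
    record { coeff = c ; coeff∈ = c∈ ; leading≉0 = c≉0 } , e

  isClosed⇒ : ∀ {ℓ} {F : Pred Ord ℓ} n → IsClosed n F → Nim.IsClosed n F
  isClosed⇒ n closed 1≤k k≤n q =
    let p , e = polyOfDegree⇒polynomial q
        α , α∈ , root = closed 1≤k k≤n p
    in α , α∈ , ≋-trans (e α) root

  ⇒isClosed : ∀ {ℓ} {F : Pred Ord ℓ} n → Nim.IsClosed n F → IsClosed n F
  ⇒isClosed n closed 1≤d d≤n p = closed 1≤d d≤n (eval-polyOfDegree p)

  ≮⇒≥ : ∀ α β → ¬ β < α → α ≤ β
  ≮⇒≥ α β β≮α with Nim.compare α β
  ... | tri< α<β _ _ = inj₁ α<β
  ... | tri≈ _ α≈β _ = inj₂ α≈β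
  ... | tri> _ _ β<α = ⊥-elim (β≮α β<α)

  record FieldSegment {ℓ} (K : Pred Ord ℓ) : Set (lsuc 0ℓ ⊔ ℓ) where
    field
      end        : Ord
      end∉       : ¬ K end
      ↓end⊆      : (↓ end) ⊆ K
      isSubfield : Nim.IsSubfield (↓ end)

    ⊆↓end : ∀ {u} → (↓ u) ⊆ K → (↓ u) ⊆ (↓ end)
    ⊆↓end {u} ↓u⊆K {α} α<u with Nim.compare α end
    ... | tri< α<end _ _ = α<end
    ... | tri≈ _ α≈end _ = ⊥-elim (end∉ (↓u⊆K {end} (Nim.<-respˡ-≈ {u} {α} {end} α≈end α<u)))
    ... | tri> _ _ end<α = ⊥-elim (end∉ (↓u⊆K {end} (Nim.<-trans {end} {α} {u} end<α α<u)))

  fieldSegment : ∀ {ℓ} {K : Pred Ord ℓ} → Nim.IsSubring K →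
    (∀ {α β} → K α → α ⊗ β ≈ 1ₒ → K β) → ∀ α → ¬ K α → FieldSegment K
  fieldSegment {K = K} K-isSubring K-inverse α α∉K =
    let v , v∉K , below = Nim.least {x = α} em (λ β → ¬ K β) α∉K
        ↓v⊆K : (↓ v) ⊆ K
        ↓v⊆K {β} β<v = decidable-stable em (below {β} β<v)
    in record
      { end        = v
      ; end∉       = v∉K
      ; ↓end⊆      = λ {β} → ↓v⊆K {β}
      ; isSubfield = Nim.↓-isSubfield K-isSubring (λ {β} {γ} → K-inverse {β} {γ})
                       v∉K (λ {β} → ↓v⊆K {β}) em
      }

  module _ (u : Ord) (u-isFieldOrdinal : IsFieldOrdinal u) where
    private
      u-isSubfield : Nim.IsSubfield (↓ u)
      u-isSubfield = isSubfield⇒ u-isFieldOrdinal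

      module Alg = Nim.Algebraic u-isSubfield

    integral⇒algebraic : Alg.IsIntegral ⊆ AlgebraicClosure u
    integral⇒algebraic {α} (d , s) =
      let f , q , fα≈0 = Nim.integral⇒root {y = α} (Nim.IsSubfield.isSubring u-isSubfield) s
          p , e = polyOfDegree⇒polynomial q
      in d , p , ≋-trans (≋-sym (e α)) fα≈0

    -- The polynomials over u, with coefficients taken among the branches of the
    -- tree of u, form a small type, and each has countably many roots at most.
    transcendental : ∃[ α ] ¬ AlgebraicClosure u α
    transcendental = ord (mex h) (mex-isOrd h λ i → isOrd (root i)) ,
      λ (d , p , αroot) → mex-∉ h (covered (ord (mex h) _) p αroot)
      where
      SmallPolynomial : Set
      SmallPolynomial =
        Σ[ d ∈ ℕ ] Σ[ c ∈ Vector (Index (tree u)) (suc d) ] branch u (c (fromℕ d)) ≉ 0ₒ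

      roots : ((d , c , _) : SmallPolynomial) → Σ[ r ∈ (ℕ → Ord) ]
        (∀ {α} → sum (λ i → branch u (c i) ⊗ α ^ toℕ i) ≈ 0ₒ → ∃[ i ] α ≈ r i)
      roots (d , c , c≉0) = Nim.finitelyManyRoots em
        (Nim.coeffs⇒polyOfDegree (λ i → branch u (c i)) _ c≉0)

      root : SmallPolynomial × ℕ → Ord
      root (p , i) = proj₁ (roots p) i

      h : SmallPolynomial × ℕ → 𝕍
      h i = tree (root i)

      covered : ∀ α {d} (p : Polynomial (↓ u) d) → IsRoot p α → ∃[ i ] tree α ≋ h i
      covered α {d} p αroot =
        let c  = λ i → proj₁ (coeff∈ p i)
            e  = λ i → proj₂ (coeff∈ p i)
            p′ = d , c , λ c≈0 → leading≉0 p (≋-trans (e (fromℕ d)) c≈0)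
            i , α≈r = proj₂ (roots p′) {α} (≋-trans
              (Nim.sum-cong {s = λ i → branch u (c i) ⊗ α ^ toℕ i} {t = λ i → coeff p i ⊗ α ^ toℕ i}
                λ i → Nim.*-congʳ {α ^ toℕ i} {branch u (c i)} {coeff p i} (≋-sym (e i))) αroot)
        in (p′ , i) , α≈r

    private
      ū-segment : FieldSegment Alg.IsIntegral
      ū-segment = fieldSegment Alg.integral-isSubring (λ {α} {β} → Alg.integral-inverse {α} {β})
        (proj₁ transcendental) λ α-int → proj₂ transcendental (integral⇒algebraic α-int)

      module ū = FieldSegment ū-segment

    ū : Ord
    ū = ū.end

    ↓u⊆↓ū : (↓ u) ⊆ (↓ ū)
    ↓u⊆↓ū {α} = ū.⊆↓end {u} (λ {β} → Alg.U⇒integral {β}) {α}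

    ū-isClosed : ∀ n → Nim.IsClosed n (↓ ū)
    ū-isClosed n = Nim.↓-isClosed ū.isSubfield n λ _ s →
      ū.end∉ (Alg.integral-trans (Nim.span-mono (λ {α} → ū.↓end⊆ {α}) s))

    algebraicClosure⊆↓ū : AlgebraicClosure u ⊆ (↓ ū)
    algebraicClosure⊆↓ū {α} (d , p , root) = Nim.isClosed⇒root∈ {x = α}
      (Nim.IsSubfield.isSubring ū.isSubfield) (ū-isClosed d) (ℕ.≤-refl)
      (Nim.polyOfDegree-mono (λ {β} → ↓u⊆↓ū {β}) (eval-polyOfDegree p)) root

    ↓ū⊆algebraicClosure : (↓ ū) ⊆ AlgebraicClosure u
    ↓ū⊆algebraicClosure {α} α<ū = integral⇒algebraic (ū.↓end⊆ {α} α<ū)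

    -- ↓ v at the level over which Closure quantifies.
    ⇑↓ : Ord → Pred Ord (lsuc 0ℓ)
    ⇑↓ v α = Lift (lsuc 0ℓ) (α < v)

    closure⊆↓ : ∀ n v → Nim.IsSubfield (↓ v) → Nim.IsClosed n (↓ v) →
      (↓ u) ⊆ (↓ v) → (↓ v) ⊆ AlgebraicClosure u → Closure n u ⊆ (↓ v)
    closure⊆↓ n v v-isSubfield v-isClosed u⊆v v⊆Alg α∈ = lower (α∈ (⇑↓ v)
      (⇒isSubfield record
        { isSubring = record
          { resp     = λ {α} {β} e (lift α∈) → lift (resp {α} {β} e α∈)
          ; 0∈       = lift 0∈
          ; 1∈       = lift 1∈
          ; +-closed = λ {α} {β} (lift α∈) (lift β∈) → lift (+-closed {α} {β} α∈ β∈)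
          ; *-closed = λ {α} {β} (lift α∈) (lift β∈) → lift (*-closed {α} {β} α∈ β∈)
          }
        ; inverse   = λ {α} (lift α∈) α≉0 →
            let β , β∈ , e = inverse {α} α∈ α≉0 in β , lift β∈ , e
        })
      (⇒isClosed n λ 1≤d d≤n q →
        let α , α∈ , e = v-isClosed 1≤d d≤n (Nim.polyOfDegree-mono lower q) in α , lift α∈ , e)
      (λ {α} α<u → lift (u⊆v {α} α<u))
      (λ {α} (lift α<v) → v⊆Alg {α} α<v))
      where open Nim.IsSubfield v-isSubfield

    root∈closure : ∀ {d} {f} n α → d ℕ.≤ n → Nim.PolyOfDegree (Closure n u) d f → f α ≈ 0ₒ →
                   Closure n u α
    root∈closure n α d≤n q fα≈0 F F-isSubfield F-isClosed u⊆F F⊆ū = Nim.isClosed⇒root∈ {x = α}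
      (Nim.IsSubfield.isSubring (isSubfield⇒ F-isSubfield)) (isClosed⇒ n F-isClosed) d≤n
      (Nim.polyOfDegree-mono (λ β∈ → β∈ F F-isSubfield F-isClosed (λ {γ} → u⊆F {γ}) F⊆ū) q) fα≈0

    ↓u⊆closure : ∀ n → (↓ u) ⊆ Closure n u
    ↓u⊆closure n {α} α<u F _ _ u⊆F _ = u⊆F {α} α<u

    closure⊆↓ū : ∀ n → Closure n u ⊆ (↓ ū)
    closure⊆↓ū n {α} = closure⊆↓ n ū ū.isSubfield (ū-isClosed n)
      (λ {β} → ↓u⊆↓ū {β}) (λ {β} → ↓ū⊆algebraicClosure {β}) {α}

    closure-isSubring : ∀ n → Nim.IsSubring (Closure n u)
    closure-isSubring n = record
      { resp     = λ {α} {β} e α∈ F S C u⊆F F⊆ū →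
          IsSubfield.resp S {α} {β} e (α∈ F S C (λ {γ} → u⊆F {γ}) F⊆ū)
      ; 0∈       = λ F S _ _ _ → IsSubfield.0∈ S
      ; 1∈       = λ F S _ _ _ → IsSubfield.1∈ S
      ; +-closed = λ α∈ β∈ F S C u⊆F F⊆ū → IsSubfield.⊕-closed S
          (α∈ F S C (λ {γ} → u⊆F {γ}) F⊆ū) (β∈ F S C (λ {γ} → u⊆F {γ}) F⊆ū)
      ; *-closed = λ α∈ β∈ F S C u⊆F F⊆ū → IsSubfield.⊗-closed S
          (α∈ F S C (λ {γ} → u⊆F {γ}) F⊆ū) (β∈ F S C (λ {γ} → u⊆F {γ}) F⊆ū)
      }

    closure-inverse : ∀ n {α β} → Closure n u α → α ⊗ β ≈ 1ₒ → Closure n u β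
    closure-inverse n {α} {β} α∈ αβ≈1 F S C u⊆F F⊆ū =
      let γ , γ∈ , αγ≈1 = IsSubfield.inv-closed S (α∈ F S C (λ {δ} → u⊆F {δ}) F⊆ū) α≉0
      in IsSubfield.resp S {γ} {β} (Nim.inverse-unique {α} {γ} {β} αγ≈1 αβ≈1) γ∈
      where
      α≉0 : α ≉ 0ₒ
      α≉0 α≈0 = Nim.<⇒≉ {0ₒ} {1ₒ} Nim.0<1 (≋-trans (≋-sym αβ≈1)
        (≋-trans (Nim.*-congʳ {β} {α} {0ₒ} α≈0) (Nim.*-zeroˡ β)))

    closure-isOrdinal : ∀ n → ∃[ β ] Closure n u IsOrdinal β
    closure-isOrdinal n = end ,
      (λ {α} → closure⊆↓ n end isSubfield
        (Nim.↓-isClosed isSubfield n λ k≤n s →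
          let f , q , e = Nim.integral⇒root {y = end} (Nim.IsSubfield.isSubring isSubfield) s
          in end∉ (root∈closure n end k≤n (Nim.polyOfDegree-mono (λ {β} → ↓end⊆ {β}) q) e))
        (λ {β} → ⊆↓end {u} (λ {γ} → ↓u⊆closure n {γ}) {β})
        (λ {β} β<end → ↓ū⊆algebraicClosure {β} (closure⊆↓ū n {β} (↓end⊆ {β} β<end))) {α}) ,
      (λ {α} → ↓end⊆ {α})
      where
      open FieldSegment (fieldSegment (closure-isSubring n) (λ {α} {β} → closure-inverse n {α} {β})
        ū (λ ū∈ → ∈-irrefl (tree ū) (closure⊆↓ū n {ū} ū∈)))

    ū-isSup : IsSup (λ β → ∃[ n ] (1 ℕ.≤ n) × (Closure n u IsOrdinal β)) ū
    ū-isSup = upper , minimal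
      where
      upper : ∀ β → ∃[ n ] (1 ℕ.≤ n) × (Closure n u IsOrdinal β) → β ≤ ū
      upper β (n , _ , _ , ↓β⊆) = ≮⇒≥ β ū λ ū<β → ∈-irrefl (tree ū) (closure⊆↓ū n {ū} (↓β⊆ {ū} ū<β))

      unbounded : ∀ τ → (∀ β → ∃[ n ] (1 ℕ.≤ n) × (Closure n u IsOrdinal β) → β ≤ τ) →
                  ¬ AlgebraicClosure u τ
      unbounded τ bound (zero , p , root) =
        Nim.polyOfDegree-0-noRoot {x = τ} (eval-polyOfDegree p) root
      unbounded τ bound (suc d , p , root) =
        let β , β-isClosure = closure-isOrdinal (suc d)
            τ<β = proj₁ β-isClosure {τ} (root∈closure (suc d) τ ℕ.≤-refl
              (Nim.polyOfDegree-mono (λ {γ} → ↓u⊆closure (suc d) {γ}) (eval-polyOfDegree p)) root)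
        in [ (λ β<τ → ∈-irrefl (tree τ) (Nim.<-trans {τ} {β} {τ} τ<β β<τ))
           , (λ β≈τ → ∈-irrefl (tree τ) (Nim.<-respʳ-≈ {τ} {β} {τ} β≈τ τ<β))
           ]′ (bound β (suc d , ℕ.s≤s ℕ.z≤n , β-isClosure))

      minimal : ∀ τ → (∀ β → ∃[ n ] (1 ℕ.≤ n) × (Closure n u IsOrdinal β) → β ≤ τ) → ū ≤ τ
      minimal τ bound = ≮⇒≥ ū τ λ τ<ū → unbounded τ bound (↓ū⊆algebraicClosure {τ} τ<ū)

lemma3p3 : (∀ {ℓ} → ExcludedMiddle ℓ) →
    (u : Ord) → IsFieldOrdinal u →
    (∀ n → 1 ℕ.≤ n → ∃[ β ] Closure n u IsOrdinal β) ×
    (∃[ ū ] (AlgebraicClosure u IsOrdinal ū) ×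
    IsSup (λ β → ∃[ n ] (1 ℕ.≤ n) × (Closure n u IsOrdinal β)) ū)
lemma3p3 em u u-isFieldOrdinal =
  (λ n _ → closure-isOrdinal em u u-isFieldOrdinal n) ,
  ū em u u-isFieldOrdinal ,
  ((λ {α} → algebraicClosure⊆↓ū em u u-isFieldOrdinal {α}) ,
   (λ {α} → ↓ū⊆algebraicClosure em u u-isFieldOrdinal {α})) ,
  ū-isSup em u u-isFieldOrdinal
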